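{- In the needle in a haystack problem on $\{0,\dots,n-1\}$, with the sought number $s$ chosen uniformly at random from $\{0,\dots,n-1\}$ (independently of the uniformly random permutation $\sigma$ and of the strategy), every strategy, deterministic or randomized, has success probability $$\Pr[\mathcal V]\le \frac{(1+o(1))\,\log n}{n\,\log\log n},$$ where $o(1)$ denotes a quantity that depends only on $n$ (not on the strategy) and tends to $0$ as $n\to\infty$.
   Context: $\log=\log_2$. $\mathbb S_n$ is the set of all permutations of $\{0,\dots,n-1\}$. Needle in a haystack problem: a permutation $\sigma\in\mathbb S_n$ is chosen uniformly at random and a number $s\in\{0,\dots,n-1\}$ is sought. A deterministic strategy is a pair of functions: a hint function $h:\mathbb S_n\to\{0,\dots,n-1\}$, which sees $\sigma$ but not $s$, and an index function $i:\{0,\dots,n-1\}^2\to\{0,\dots,n-1\}$, which sees only the hint $h(\sigma)$ and $s$. The strategy succeeds (event $\mathcal V$) if $\sigma(i(h(\sigma),s))=s$. A randomized strategy is a probability distribution over deterministic strategies, with the strategy drawn independently of $(\sigma,s)$. $\Pr[\mathcal V]$ is the probability of success over $\sigma$, $s$ and the randomness of the strategy. -}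

module Defs where

open import Data.Nat.Induction using (<-rec)
open import Data.Nat.Logarithm using (⌊log₂_⌋; ⌊log₂⌋-mono-≤; ⌊log₂⌊n/2⌋⌋≡⌊log₂n⌋∸1; ⌊log₂[2^n]⌋≡n)
import Data.Nat.Tactic.RingSolver as ℕ-Ring
open import Relation.Binary.PropositionalEquality using (_≡_; refl; sym; trans; cong; cong₂; subst; subst₂)

module ℕ-Logarithm where

  open import Data.Nat
  open import Data.Nat.Properties

  2^⌊log₂n⌋≤n : ∀ n .{{_ : NonZero n}} → 2 ^ ⌊log₂ n ⌋ ≤ n
  2^⌊log₂n⌋≤n = <-rec (λ n → .{{_ : NonZero n}} → 2 ^ ⌊log₂ n ⌋ ≤ n) step
    where
    open ≤-Reasoning
    step : ∀ n → (∀ {m} → m < n → .{{_ : NonZero m}} → 2 ^ ⌊log₂ m ⌋ ≤ m) →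
           .{{_ : NonZero n}} → 2 ^ ⌊log₂ n ⌋ ≤ n
    step 1             rec = ≤-refl
    step n@(suc (suc m)) rec = begin
      2 ^ ⌊log₂ n ⌋               ≤⟨ ^-monoʳ-≤ 2 (m≤n+m∸n ⌊log₂ n ⌋ 1) ⟩
      2 * 2 ^ (⌊log₂ n ⌋ ∸ 1)     ≡⟨ cong (λ l → 2 * 2 ^ l) (⌊log₂⌊n/2⌋⌋≡⌊log₂n⌋∸1 n) ⟨
      2 * 2 ^ ⌊log₂ ⌊ n /2⌋ ⌋     ≤⟨ *-monoʳ-≤ 2 (rec (⌊n/2⌋<n (suc m))) ⟩
      2 * ⌊ n /2⌋                 ≡⟨ cong (⌊ n /2⌋ +_) (+-identityʳ _) ⟩
      ⌊ n /2⌋ + ⌊ n /2⌋           ≤⟨ +-monoʳ-≤ ⌊ n /2⌋ (⌊n/2⌋≤⌈n/2⌉ n) ⟩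
      ⌊ n /2⌋ + ⌈ n /2⌉           ≡⟨ ⌊n/2⌋+⌈n/2⌉≡n n ⟩
      n                           ∎

  n<2^1+⌊log₂n⌋ : ∀ n → n < 2 ^ suc ⌊log₂ n ⌋
  n<2^1+⌊log₂n⌋ n = ≰⇒> λ 2^l≤n → 1+n≰n (≤-trans
    (≤-reflexive (sym (⌊log₂[2^n]⌋≡n (suc ⌊log₂ n ⌋)))) (⌊log₂⌋-mono-≤ 2^l≤n))

  ^-cancelʳ-≤ : ∀ {i j} → 2 ^ i ≤ 2 ^ j → i ≤ j
  ^-cancelʳ-≤ {i} {j} le = ≮⇒≥ λ j<i → <⇒≱ (^-monoʳ-< 2 ≤-refl j<i) le

  bernoulli : ∀ s t → suc s ^ t * suc s ≤ s ^ t * suc s + t * suc s ^ t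
  bernoulli s zero    = m≤m+n _ 0
  bernoulli s (suc t) = begin
    suc s * suc s ^ t * suc s                          ≡⟨ *-assoc (suc s) (suc s ^ t) (suc s) ⟩
    suc s * (suc s ^ t * suc s)                        ≤⟨ *-monoʳ-≤ (suc s) (bernoulli s t) ⟩
    suc s * (s ^ t * suc s + t * suc s ^ t)            ≡⟨ expand s (s ^ t) (suc s ^ t) t ⟩
    s * s ^ t * suc s + t * (suc s * suc s ^ t) + suc s * s ^ t
      ≤⟨ +-monoʳ-≤ (s * s ^ t * suc s + t * (suc s * suc s ^ t)) (*-monoʳ-≤ (suc s) (^-monoˡ-≤ t (n≤1+n s))) ⟩
    s * s ^ t * suc s + t * (suc s * suc s ^ t) + suc s * suc s ^ t ≡⟨ collect s (s ^ t) (suc s ^ t) t ⟩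
    s * s ^ t * suc s + suc t * (suc s * suc s ^ t)    ∎
    where
    open ≤-Reasoning
    expand : ∀ s u v t → suc s * (u * suc s + t * v) ≡ s * u * suc s + t * (suc s * v) + suc s * u
    expand = ℕ-Ring.solve-∀
    collect : ∀ s u v t → s * u * suc s + t * (suc s * v) + suc s * v ≡ s * u * suc s + suc t * (suc s * v)
    collect = ℕ-Ring.solve-∀

  [1+1/2h]^h≤2 : ∀ h → suc (2 * h) ^ h ≤ 2 * (2 * h) ^ h
  [1+1/2h]^h≤2 h = *-cancelʳ-≤ _ _ (suc (2 * h)) (+-cancelʳ-≤ (X * suc (2 * h)) _ _ (begin
    X * suc (2 * h) + X * suc (2 * h)               ≤⟨ +-mono-≤ (bernoulli (2 * h) h) (bernoulli (2 * h) h) ⟩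
    (Y * suc (2 * h) + h * X) + (Y * suc (2 * h) + h * X) ≡⟨ eq X Y h ⟩
    2 * Y * suc (2 * h) + X * (2 * h)               ≤⟨ +-monoʳ-≤ (2 * Y * suc (2 * h)) (*-monoʳ-≤ X (n≤1+n (2 * h))) ⟩
    2 * Y * suc (2 * h) + X * suc (2 * h)           ∎))
    where
    open ≤-Reasoning
    X = suc (2 * h) ^ h
    Y = (2 * h) ^ h
    eq : ∀ x y h → (y * suc (2 * h) + h * x) + (y * suc (2 * h) + h * x) ≡ 2 * y * suc (2 * h) + x * (2 * h)
    eq = ℕ-Ring.solve-∀

  ^-distribʳ-* : ∀ m n e → (m * n) ^ e ≡ m ^ e * n ^ e
  ^-distribʳ-* m n zero = refl
  ^-distribʳ-* m n (suc e) = trans (cong (m * n *_) (^-distribʳ-* m n e)) (eq m n (m ^ e) (n ^ e))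
    where
    eq : ∀ m n x y → m * n * (x * y) ≡ m * x * (n * y)
    eq = ℕ-Ring.solve-∀

  2^-lower : ∀ x k e .{{_ : NonZero x}} → 2 ^ (⌊log₂ x ^ k ⌋ * e) ≤ x ^ (k * e)
  2^-lower x k e = begin
    2 ^ (⌊log₂ x ^ k ⌋ * e)  ≡⟨ ^-*-assoc 2 ⌊log₂ x ^ k ⌋ e ⟨
    (2 ^ ⌊log₂ x ^ k ⌋) ^ e  ≤⟨ ^-monoˡ-≤ e (2^⌊log₂n⌋≤n (x ^ k) {{m^n≢0 x k}}) ⟩
    (x ^ k) ^ e              ≡⟨ ^-*-assoc x k e ⟩
    x ^ (k * e)              ∎
    where open ≤-Reasoning

  2^-upper : ∀ x k e → x ^ (k * e) ≤ 2 ^ (suc ⌊log₂ x ^ k ⌋ * e)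
  2^-upper x k e = begin
    x ^ (k * e)              ≡⟨ ^-*-assoc x k e ⟨
    (x ^ k) ^ e              ≤⟨ ^-monoˡ-≤ e (<⇒≤ (n<2^1+⌊log₂n⌋ (x ^ k))) ⟩
    (2 ^ suc ⌊log₂ x ^ k ⌋) ^ e  ≡⟨ ^-*-assoc 2 (suc ⌊log₂ x ^ k ⌋) e ⟩
    2 ^ (suc ⌊log₂ x ^ k ⌋ * e)  ∎
    where open ≤-Reasoning

  ⌊log₂⌋-compare : ∀ a b a′ b′ J K h .{{_ : NonZero a}} .{{_ : NonZero b′}} .{{_ : NonZero h}} →
    2 * h * (a * b′) ≤ suc (2 * h) * (a′ * b) →
    ⌊log₂ a ^ J ⌋ * (K * h) + ⌊log₂ b′ ^ K ⌋ * (J * h) ≤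
    J * K + (suc ⌊log₂ a′ ^ K ⌋ * (J * h) + suc ⌊log₂ b ^ J ⌋ * (K * h))
  ⌊log₂⌋-compare a b a′ b′ J K h hyp = ^-cancelʳ-≤ (begin
    2 ^ (⌊log₂ a ^ J ⌋ * (K * h) + ⌊log₂ b′ ^ K ⌋ * (J * h))       ≡⟨ ^-distribˡ-+-* 2 (⌊log₂ a ^ J ⌋ * (K * h)) _ ⟩
    2 ^ (⌊log₂ a ^ J ⌋ * (K * h)) * 2 ^ (⌊log₂ b′ ^ K ⌋ * (J * h)) ≤⟨ *-mono-≤ (2^-lower a J (K * h)) (2^-lower b′ K (J * h)) ⟩
    a ^ (J * (K * h)) * b′ ^ (K * (J * h))                         ≡⟨ cong₂ (λ x y → a ^ x * b′ ^ y) (*-assoc J K h) e′ ⟨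
    a ^ e * b′ ^ e                                                 ≡⟨ ^-distribʳ-* a b′ e ⟨
    (a * b′) ^ e                                                   ≤⟨ main ⟩
    2 ^ (J * K) * (a′ * b) ^ e                                     ≡⟨ cong (2 ^ (J * K) *_) (^-distribʳ-* a′ b e) ⟩
    2 ^ (J * K) * (a′ ^ e * b ^ e)                                 ≡⟨ cong (2 ^ (J * K) *_) (cong₂ (λ x y → a′ ^ x * b ^ y) e′ (*-assoc J K h)) ⟩
    2 ^ (J * K) * (a′ ^ (K * (J * h)) * b ^ (J * (K * h)))         ≤⟨ *-monoʳ-≤ (2 ^ (J * K)) (*-mono-≤ (2^-upper a′ K (J * h)) (2^-upper b J (K * h))) ⟩
    2 ^ (J * K) * (2 ^ (suc ⌊log₂ a′ ^ K ⌋ * (J * h)) * 2 ^ (suc ⌊log₂ b ^ J ⌋ * (K * h)))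
      ≡⟨ cong (2 ^ (J * K) *_) (^-distribˡ-+-* 2 (suc ⌊log₂ a′ ^ K ⌋ * (J * h)) _) ⟨
    2 ^ (J * K) * 2 ^ (suc ⌊log₂ a′ ^ K ⌋ * (J * h) + suc ⌊log₂ b ^ J ⌋ * (K * h))
      ≡⟨ ^-distribˡ-+-* 2 (J * K) _ ⟨
    2 ^ (J * K + (suc ⌊log₂ a′ ^ K ⌋ * (J * h) + suc ⌊log₂ b ^ J ⌋ * (K * h))) ∎)
    where
    open ≤-Reasoning
    e = J * K * h
    e′ : J * K * h ≡ K * (J * h)
    e′ = trans (cong (_* h) (*-comm J K)) (*-assoc K J h)
    ^e : ∀ x → x ^ e ≡ (x ^ h) ^ (J * K)
    ^e x = trans (cong (x ^_) (*-comm (J * K) h)) (sym (^-*-assoc x h (J * K)))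
    shuffle : ∀ x y z → x * y * z ≡ y * (x * z)
    shuffle = ℕ-Ring.solve-∀
    instance
      2h≢0 : NonZero (2 * h)
      2h≢0 = m*n≢0 2 h
      2h^e≢0 : NonZero ((2 * h) ^ e)
      2h^e≢0 = m^n≢0 (2 * h) e
    main : (a * b′) ^ e ≤ 2 ^ (J * K) * (a′ * b) ^ e
    main = *-cancelˡ-≤ ((2 * h) ^ e) (begin
      (2 * h) ^ e * (a * b′) ^ e                        ≡⟨ ^-distribʳ-* (2 * h) (a * b′) e ⟨
      (2 * h * (a * b′)) ^ e                            ≤⟨ ^-monoˡ-≤ e hyp ⟩
      (suc (2 * h) * (a′ * b)) ^ e                      ≡⟨ ^-distribʳ-* (suc (2 * h)) (a′ * b) e ⟩
      suc (2 * h) ^ e * (a′ * b) ^ e                    ≡⟨ cong (_* (a′ * b) ^ e) (^e (suc (2 * h))) ⟩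
      (suc (2 * h) ^ h) ^ (J * K) * (a′ * b) ^ e        ≤⟨ *-monoˡ-≤ ((a′ * b) ^ e) (^-monoˡ-≤ (J * K) ([1+1/2h]^h≤2 h)) ⟩
      (2 * (2 * h) ^ h) ^ (J * K) * (a′ * b) ^ e        ≡⟨ cong (_* (a′ * b) ^ e) (^-distribʳ-* 2 ((2 * h) ^ h) (J * K)) ⟩
      2 ^ (J * K) * ((2 * h) ^ h) ^ (J * K) * (a′ * b) ^ e ≡⟨ cong (λ x → 2 ^ (J * K) * x * (a′ * b) ^ e) (^e (2 * h)) ⟨
      2 ^ (J * K) * (2 * h) ^ e * (a′ * b) ^ e          ≡⟨ shuffle (2 ^ (J * K)) ((2 * h) ^ e) ((a′ * b) ^ e) ⟩
      (2 * h) ^ e * (2 ^ (J * K) * (a′ * b) ^ e)        ∎)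

  ⌊log₂⌋-lower : ∀ a b p r K .{{_ : NonZero b}} → 2 ^ p * b ^ r ≤ a ^ r →
    p * K + ⌊log₂ b ^ K ⌋ * r ≤ suc ⌊log₂ a ^ K ⌋ * r
  ⌊log₂⌋-lower a b p r K hyp = ^-cancelʳ-≤ (begin
    2 ^ (p * K + ⌊log₂ b ^ K ⌋ * r)       ≡⟨ ^-distribˡ-+-* 2 (p * K) _ ⟩
    2 ^ (p * K) * 2 ^ (⌊log₂ b ^ K ⌋ * r) ≤⟨ *-monoʳ-≤ (2 ^ (p * K)) (2^-lower b K r) ⟩
    2 ^ (p * K) * b ^ (K * r)             ≡⟨ cong₂ _*_ (^-*-assoc 2 p K) (trans (^-*-assoc b r K) (cong (b ^_) (*-comm r K))) ⟨
    (2 ^ p) ^ K * (b ^ r) ^ K             ≡⟨ ^-distribʳ-* (2 ^ p) (b ^ r) K ⟨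
    (2 ^ p * b ^ r) ^ K                   ≤⟨ ^-monoˡ-≤ K hyp ⟩
    (a ^ r) ^ K                           ≡⟨ trans (^-*-assoc a r K) (cong (a ^_) (*-comm r K)) ⟩
    a ^ (K * r)                           ≤⟨ 2^-upper a K r ⟩
    2 ^ (suc ⌊log₂ a ^ K ⌋ * r)           ∎)
    where open ≤-Reasoning

  ⌊log₂⌋-upper : ∀ a b p r K .{{_ : NonZero a}} → a ^ r ≤ 2 ^ p * b ^ r →
    ⌊log₂ a ^ K ⌋ * r ≤ p * K + suc ⌊log₂ b ^ K ⌋ * r
  ⌊log₂⌋-upper a b p r K hyp = ^-cancelʳ-≤ (begin
    2 ^ (⌊log₂ a ^ K ⌋ * r)               ≤⟨ 2^-lower a K r ⟩
    a ^ (K * r)                           ≡⟨ trans (^-*-assoc a r K) (cong (a ^_) (*-comm r K)) ⟨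
    (a ^ r) ^ K                           ≤⟨ ^-monoˡ-≤ K hyp ⟩
    (2 ^ p * b ^ r) ^ K                   ≡⟨ ^-distribʳ-* (2 ^ p) (b ^ r) K ⟩
    (2 ^ p) ^ K * (b ^ r) ^ K             ≡⟨ cong₂ _*_ (^-*-assoc 2 p K) (trans (^-*-assoc b r K) (cong (b ^_) (*-comm r K))) ⟩
    2 ^ (p * K) * b ^ (K * r)             ≤⟨ *-monoʳ-≤ (2 ^ (p * K)) (2^-upper b K r) ⟩
    2 ^ (p * K) * 2 ^ (suc ⌊log₂ b ^ K ⌋ * r) ≡⟨ ^-distribˡ-+-* 2 (p * K) _ ⟨
    2 ^ (p * K + suc ⌊log₂ b ^ K ⌋ * r)   ∎)
    where open ≤-Reasoning

open ℕ-Logarithm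

open import Data.Fin as Fin using (Fin)
open import Data.Fin.Permutation using (Permutation′; _⟨$⟩ʳ_; _≈_; insert; remove; insert-remove) renaming (id to idₚ)
open import Data.Integer as ℤ using (ℤ; +_; +[1+_])
import Data.Integer.Properties as ℤ
import Data.Integer.Tactic.RingSolver as ℤ-Ring
open import Data.List using (List; []; _∷_; [_]; length; filter; map; foldr; allFin; cartesianProduct; cartesianProductWith)
open import Data.List.Membership.Propositional.Properties using (∈-allFin)
open import Data.List.Properties using (length-++; length-map; length-tabulate)
open import Data.List.Relation.Unary.All using (All)
open import Data.List.Relation.Unary.Any as Any using (Any; here)
import Data.List.Relation.Unary.Any.Properties as Any
open import Data.Nat as ℕ using (ℕ; zero; suc; _!)
open import Data.Nat.Coprimality using (1-coprimeTo) renaming (sym to coprime-sym)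
import Data.Nat.Properties as ℕ
open import Data.Product using (∃-syntax; _×_; _,_; proj₁; proj₂)
open import Data.Rational as ℚ using (ℚ; mkℚ; 0ℚ; 1ℚ; ½; ↥_; ↧ₙ_; toℚᵘ)
import Data.Rational.Properties as ℚ
open import Data.Rational.Solver using (module +-*-Solver)
open import Data.Rational.Unnormalised as ℚᵘ using (mkℚᵘ)
import Data.Rational.Unnormalised.Properties as ℚᵘ
open import Data.Sum using (inj₁; inj₂)
open import Relation.Nullary using (yes; no)
open import Relation.Unary using (Decidable)

half-positive : ∀ {δ} → 0ℚ ℚ.< δ → 0ℚ ℚ.< ½ ℚ.* δ
half-positive {δ} 0<δ = subst (ℚ._< ½ ℚ.* δ) (ℚ.*-zeroʳ ½) (ℚ.*-monoʳ-<-pos ½ 0<δ)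

half+half : ∀ δ → ½ ℚ.* δ ℚ.+ ½ ℚ.* δ ≡ δ
half+half δ = trans (sym (ℚ.*-distribʳ-+ δ ½ ½)) (ℚ.*-identityˡ δ)

*-positive : ∀ {p q} → 0ℚ ℚ.< p → 0ℚ ℚ.< q → 0ℚ ℚ.< p ℚ.* q
*-positive {p} {q} 0<p 0<q = subst (ℚ._< p ℚ.* q) (ℚ.*-zeroʳ p) (ℚ.*-monoʳ-<-pos p {{ℚ.positive 0<p}} 0<q)

p≤∣p∣ : ∀ p → p ℚ.≤ ℚ.∣ p ∣
p≤∣p∣ p with ℚ.≤-total 0ℚ p
... | inj₁ 0≤p = ℚ.≤-reflexive (sym (ℚ.0≤p⇒∣p∣≡p 0≤p))
... | inj₂ p≤0 = ℚ.≤-trans p≤0 (ℚ.0≤∣p∣ p)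

∣x-y∣≡∣y-x∣ : ∀ x y → ℚ.∣ x ℚ.- y ∣ ≡ ℚ.∣ y ℚ.- x ∣
∣x-y∣≡∣y-x∣ x y = trans (sym (ℚ.∣-p∣≡∣p∣ (x ℚ.- y)))
  (cong ℚ.∣_∣ (solve 2 (λ a b → :- (a :+ :- b) := b :+ :- a) refl x y))
  where open +-*-Solver

∣x-y∣≤⇒x≤y+ : ∀ {x y δ} → ℚ.∣ x ℚ.- y ∣ ℚ.≤ δ → x ℚ.≤ y ℚ.+ δ
∣x-y∣≤⇒x≤y+ {x} {y} {δ} le = subst (ℚ._≤ y ℚ.+ δ)
  (solve 2 (λ a b → b :+ (a :+ :- b) := a) refl x y)
  (ℚ.+-monoʳ-≤ y (ℚ.≤-trans (p≤∣p∣ (x ℚ.- y)) le))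
  where open +-*-Solver

x≤y+⇒x-y≤ : ∀ {x y δ} → x ℚ.≤ y ℚ.+ δ → x ℚ.- y ℚ.≤ δ
x≤y+⇒x-y≤ {x} {y} {δ} le = subst (x ℚ.- y ℚ.≤_)
  (solve 2 (λ b d → (b :+ d) :+ :- b := d) refl y δ) (ℚ.+-monoˡ-≤ (ℚ.- y) le)
  where open +-*-Solver

≤+⇒∣x-y∣≤ : ∀ {x y δ} → x ℚ.≤ y ℚ.+ δ → y ℚ.≤ x ℚ.+ δ → ℚ.∣ x ℚ.- y ∣ ℚ.≤ δ
≤+⇒∣x-y∣≤ {x} {y} {δ} x≤ y≤ with ℚ.∣p∣≡p∨∣p∣≡-p (x ℚ.- y)
... | inj₁ eq = subst (ℚ._≤ δ) (sym eq) (x≤y+⇒x-y≤ {x} {y} x≤)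
... | inj₂ eq = subst (ℚ._≤ δ) (sym (trans eq (solve 2 (λ a b → :- (a :+ :- b) := b :+ :- a) refl x y))) (x≤y+⇒x-y≤ {y} {x} y≤)
  where open +-*-Solver

-- Total reciprocal, with inv 0 = 0.
inv : ℚ → ℚ
inv   (mkℚ (+ zero) _ _)    = 0ℚ
inv p@(mkℚ +[1+ _ ] _ _)    = ℚ.1/ p
inv p@(mkℚ (ℤ.-[1+ _ ]) _ _) = ℚ.1/ p

inv-inverse : ∀ {p} → 0ℚ ℚ.< p → inv p ℚ.* p ≡ 1ℚ
inv-inverse {mkℚ (+ zero) _ _}      (ℚ.*<* (ℤ.+<+ ()))
inv-inverse {p@(mkℚ +[1+ _ ] _ _)}  _ = ℚ.*-inverseˡ p
inv-inverse {p@(mkℚ ℤ.-[1+ _ ] _ _)} _ = ℚ.*-inverseˡ p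

inv-positive : ∀ {p} → 0ℚ ℚ.< p → 0ℚ ℚ.< inv p
inv-positive {mkℚ (+ zero) _ _}      (ℚ.*<* (ℤ.+<+ ()))
inv-positive {p@(mkℚ +[1+ _ ] _ _)}  _ = ℚ.positive⁻¹ (ℚ.1/ p) {{ℚ.1/pos⇒pos p}}
inv-positive {p@(mkℚ ℤ.-[1+ _ ] _ _)} (ℚ.*<* ())

inv-antimono : ∀ {p q} → 0ℚ ℚ.< p → p ℚ.≤ q → inv q ℚ.≤ inv p
inv-antimono {p} {q} 0<p p≤q = begin
  inv q                     ≡⟨ ℚ.*-identityʳ (inv q) ⟨
  inv q ℚ.* 1ℚ              ≡⟨ cong (inv q ℚ.*_) (trans (ℚ.*-comm p (inv p)) (inv-inverse 0<p)) ⟨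
  inv q ℚ.* (p ℚ.* inv p)   ≤⟨ ℚ.*-monoˡ-≤-nonNeg (inv q) {{ℚ.nonNegative (ℚ.<⇒≤ (inv-positive 0<q))}}
                                 (ℚ.*-monoʳ-≤-nonNeg (inv p) {{ℚ.nonNegative (ℚ.<⇒≤ (inv-positive 0<p))}} p≤q) ⟩
  inv q ℚ.* (q ℚ.* inv p)   ≡⟨ ℚ.*-assoc (inv q) q (inv p) ⟨
  inv q ℚ.* q ℚ.* inv p     ≡⟨ cong (ℚ._* inv p) (inv-inverse 0<q) ⟩
  1ℚ ℚ.* inv p              ≡⟨ ℚ.*-identityˡ (inv p) ⟩
  inv p                     ∎
  where
  open ℚ.≤-Reasoning
  0<q = ℚ.<-≤-trans 0<p p≤q

inv-lipschitz : ∀ {c δ x y} → 0ℚ ℚ.< c → 0ℚ ℚ.≤ δ → c ℚ.≤ x → c ℚ.≤ y →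
  ℚ.∣ x ℚ.- y ∣ ℚ.≤ δ ℚ.* (c ℚ.* c) → ℚ.∣ inv x ℚ.- inv y ∣ ℚ.≤ δ
inv-lipschitz {c} {δ} {x} {y} 0<c 0≤δ c≤x c≤y le = begin
  ℚ.∣ inv x ℚ.- inv y ∣                     ≡⟨ cong ℚ.∣_∣ eq ⟩
  ℚ.∣ inv x ℚ.* inv y ℚ.* (y ℚ.- x) ∣       ≡⟨ ℚ.∣p*q∣≡∣p∣*∣q∣ (inv x ℚ.* inv y) (y ℚ.- x) ⟩
  ℚ.∣ inv x ℚ.* inv y ∣ ℚ.* ℚ.∣ y ℚ.- x ∣   ≡⟨ cong₂ ℚ._*_ (ℚ.0≤p⇒∣p∣≡p (ℚ.<⇒≤ (*-positive 0<ix 0<iy))) (∣x-y∣≡∣y-x∣ y x) ⟩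
  inv x ℚ.* inv y ℚ.* ℚ.∣ x ℚ.- y ∣         ≤⟨ ℚ.*-monoˡ-≤-nonNeg (inv x ℚ.* inv y) {{nn (*-positive 0<ix 0<iy)}} le ⟩
  inv x ℚ.* inv y ℚ.* (δ ℚ.* (c ℚ.* c))     ≤⟨ ℚ.*-monoʳ-≤-nonNeg (δ ℚ.* (c ℚ.* c)) {{δcc}} (ℚ.*-monoˡ-≤-nonNeg (inv x) {{nn 0<ix}} (inv-antimono 0<c c≤y)) ⟩
  inv x ℚ.* inv c ℚ.* (δ ℚ.* (c ℚ.* c))     ≤⟨ ℚ.*-monoʳ-≤-nonNeg (δ ℚ.* (c ℚ.* c)) {{δcc}} (ℚ.*-monoʳ-≤-nonNeg (inv c) {{nn 0<ic}} (inv-antimono 0<c c≤x)) ⟩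
  inv c ℚ.* inv c ℚ.* (δ ℚ.* (c ℚ.* c))     ≡⟨ solve 3 (λ i c d → i :* i :* (d :* (c :* c)) := (i :* c) :* ((i :* c) :* d)) refl (inv c) c δ ⟩
  (inv c ℚ.* c) ℚ.* ((inv c ℚ.* c) ℚ.* δ)   ≡⟨ cong (λ t → t ℚ.* (t ℚ.* δ)) (inv-inverse 0<c) ⟩
  1ℚ ℚ.* (1ℚ ℚ.* δ)                         ≡⟨ trans (ℚ.*-identityˡ _) (ℚ.*-identityˡ δ) ⟩
  δ                                         ∎
  where
  open ℚ.≤-Reasoning
  open +-*-Solver
  nn : ∀ {p} → 0ℚ ℚ.< p → ℚ.NonNegative p
  nn 0<p = ℚ.nonNegative (ℚ.<⇒≤ 0<p)
  0<ix = inv-positive (ℚ.<-≤-trans 0<c c≤x)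
  0<iy = inv-positive (ℚ.<-≤-trans 0<c c≤y)
  0<ic = inv-positive 0<c
  δcc : ℚ.NonNegative (δ ℚ.* (c ℚ.* c))
  δcc = ℚ.nonNeg*nonNeg⇒nonNeg δ {{ℚ.nonNegative 0≤δ}} (c ℚ.* c) {{nn (*-positive 0<c 0<c)}}
  eq : inv x ℚ.- inv y ≡ inv x ℚ.* inv y ℚ.* (y ℚ.- x)
  eq = sym (trans (solve 4 (λ u v x y → u :* v :* (y :+ :- x) := u :* (v :* y) :+ :- (v :* (u :* x))) refl (inv x) (inv y) x y)
     (trans (cong₂ (λ s t → inv x ℚ.* s ℚ.- inv y ℚ.* t) (inv-inverse (ℚ.<-≤-trans 0<c c≤y)) (inv-inverse (ℚ.<-≤-trans 0<c c≤x)))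
            (cong₂ ℚ._-_ (ℚ.*-identityʳ (inv x)) (ℚ.*-identityʳ (inv y)))))

*-lipschitz : ∀ {A B δ δ′ x y x′ y′} → ℚ.∣ x ∣ ℚ.≤ A → ℚ.∣ y′ ∣ ℚ.≤ B →
  ℚ.∣ x ℚ.- x′ ∣ ℚ.≤ δ → ℚ.∣ y ℚ.- y′ ∣ ℚ.≤ δ′ →
  ℚ.∣ x ℚ.* y ℚ.- x′ ℚ.* y′ ∣ ℚ.≤ A ℚ.* δ′ ℚ.+ δ ℚ.* B
*-lipschitz {A} {B} {δ} {δ′} {x} {y} {x′} {y′} x≤ y′≤ dx dy = begin
  ℚ.∣ x ℚ.* y ℚ.- x′ ℚ.* y′ ∣
    ≡⟨ cong ℚ.∣_∣ (solve 4 (λ x y u v → x :* y :+ :- (u :* v) := x :* (y :+ :- v) :+ (x :+ :- u) :* v) refl x y x′ y′) ⟩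
  ℚ.∣ x ℚ.* (y ℚ.- y′) ℚ.+ (x ℚ.- x′) ℚ.* y′ ∣
    ≤⟨ ℚ.∣p+q∣≤∣p∣+∣q∣ (x ℚ.* (y ℚ.- y′)) ((x ℚ.- x′) ℚ.* y′) ⟩
  ℚ.∣ x ℚ.* (y ℚ.- y′) ∣ ℚ.+ ℚ.∣ (x ℚ.- x′) ℚ.* y′ ∣
    ≡⟨ cong₂ ℚ._+_ (ℚ.∣p*q∣≡∣p∣*∣q∣ x (y ℚ.- y′)) (ℚ.∣p*q∣≡∣p∣*∣q∣ (x ℚ.- x′) y′) ⟩
  ℚ.∣ x ∣ ℚ.* ℚ.∣ y ℚ.- y′ ∣ ℚ.+ ℚ.∣ x ℚ.- x′ ∣ ℚ.* ℚ.∣ y′ ∣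
    ≤⟨ ℚ.+-mono-≤ (mono x≤ dy) (mono dx y′≤) ⟩
  A ℚ.* δ′ ℚ.+ δ ℚ.* B ∎
  where
  open ℚ.≤-Reasoning
  open +-*-Solver
  mono : ∀ {p q r s} → ℚ.∣ p ∣ ℚ.≤ r → ℚ.∣ q ∣ ℚ.≤ s → ℚ.∣ p ∣ ℚ.* ℚ.∣ q ∣ ℚ.≤ r ℚ.* s
  mono {p} {q} {r} {s} pr qs = ℚ.≤-trans (ℚ.*-monoˡ-≤-nonNeg ℚ.∣ p ∣ {{ℚ.∣-∣-nonNeg p}} qs)
    (ℚ.*-monoʳ-≤-nonNeg s {{ℚ.nonNegative (ℚ.≤-trans (ℚ.0≤∣p∣ q) qs)}} pr)

-- For q = a / b > 0 this is (⌊log₂ aᵏ⁺¹⌋ - ⌊log₂ bᵏ⁺¹⌋) / (k + 1), which is within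
-- 1 / (k + 1) of log₂ q; see log≈-lower and log≈-upper. For q ≤ 0 the value is junk.
log≈ : ℕ → ℚ → ℚ
log≈ k q = (+ ⌊log₂ ℤ.∣ ↥ q ∣ ℕ.^ suc k ⌋ ℤ.- + ⌊log₂ ↧ₙ q ℕ.^ suc k ⌋) ℚ./ suc k

toℚᵘ-/ : ∀ z k → toℚᵘ (z ℚ./ suc k) ℚᵘ.≃ mkℚᵘ z k
toℚᵘ-/ z k = ℚ.toℚᵘ-fromℚᵘ (mkℚᵘ z k)

ratio : ∀ h .{{_ : ℕ.NonZero h}} {c x y} → 0ℚ ℚ.< x → c ℚ.≤ y → 0ℚ ℚ.< y → 
  x ℚ.≤ y ℚ.+ c ℚ.* (+ 1 ℚ./ (2 ℕ.* h)) {{ℕ.m*n≢0 2 h}} →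
  2 ℕ.* h ℕ.* (ℤ.∣ ↥ x ∣ ℕ.* ↧ₙ y) ℕ.≤ suc (2 ℕ.* h) ℕ.* (ℤ.∣ ↥ y ∣ ℕ.* ↧ₙ x)
ratio _ {x = mkℚ (+ zero) _ _} (ℚ.*<* (ℤ.+<+ ()))
ratio _ {x = mkℚ ℤ.-[1+ _ ] _ _} (ℚ.*<* ())
ratio _ {x = mkℚ +[1+ _ ] _ _} {mkℚ (+ zero) _ _} _ _ (ℚ.*<* (ℤ.+<+ ()))
ratio _ {x = mkℚ +[1+ _ ] _ _} {mkℚ ℤ.-[1+ _ ] _ _} _ _ (ℚ.*<* ())
ratio h@(suc h-1) {c} {x@(mkℚ +[1+ a ] b _)} {y@(mkℚ +[1+ a′ ] b′ _)} _ c≤y _ hyp =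
  ℕ.*-cancelˡ-≤ (suc b′) (subst₂ ℕ._≤_ (eq₁ H (suc a) (suc b′)) (eq₂ H (suc a′) (suc b) (suc b′)) (ℤ.drop‿+≤+ (ℚᵘ.drop-*≤* step)))
  where
  H = 2 ℕ.* h
  ih : ℚ
  ih = + 1 ℚ./ H
  instance
    ih≥0 : ℚ.NonNegative ih
    ih≥0 = ℚ.normalize-nonNeg 1 H
  step : mkℚᵘ +[1+ a ] b ℚᵘ.≤ mkℚᵘ +[1+ a′ ] b′ ℚᵘ.+ mkℚᵘ +[1+ a′ ] b′ ℚᵘ.* mkℚᵘ (+ 1) (ℕ.pred H)
  step = ℚᵘ.≤-respʳ-≃ (ℚᵘ.≃-trans (ℚ.toℚᵘ-homo-+ y (y ℚ.* ih))
      (ℚᵘ.+-congʳ (toℚᵘ y) (ℚᵘ.≃-trans (ℚ.toℚᵘ-homo-* y ih) (ℚᵘ.*-congˡ {toℚᵘ y} (toℚᵘ-/ (+ 1) (ℕ.pred H))))))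
    (ℚ.toℚᵘ-mono-≤ (ℚ.≤-trans hyp (ℚ.+-monoʳ-≤ y (ℚ.*-monoʳ-≤-nonNeg ih c≤y))))
  eq₁ : ∀ H a b′ → a ℕ.* (b′ ℕ.* (b′ ℕ.* H)) ≡ b′ ℕ.* (H ℕ.* (a ℕ.* b′))
  eq₁ = ℕ-Ring.solve-∀
  eq₂ : ∀ H a′ b b′ → (a′ ℕ.* (b′ ℕ.* H) ℕ.+ a′ ℕ.* 1 ℕ.* b′) ℕ.* b ≡ b′ ℕ.* (suc H ℕ.* (a′ ℕ.* b))
  eq₂ = ℕ-Ring.solve-∀

num-nonZero : ∀ {q} → 0ℚ ℚ.< q → ℕ.NonZero ℤ.∣ ↥ q ∣
num-nonZero {mkℚ (+ zero) _ _} (ℚ.*<* (ℤ.+<+ ()))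
num-nonZero {mkℚ +[1+ _ ] _ _} _ = _
num-nonZero {mkℚ ℤ.-[1+ _ ] _ _} (ℚ.*<* ())

fraction-≤ : ∀ A B A′ B′ j k r r-num r-den → toℚᵘ r ℚᵘ.≃ mkℚᵘ (+ r-num) r-den →
  A ℕ.* (suc k ℕ.* suc r-den) ℕ.+ B′ ℕ.* (suc j ℕ.* suc r-den) ℕ.≤
  A′ ℕ.* (suc j ℕ.* suc r-den) ℕ.+ B ℕ.* (suc k ℕ.* suc r-den) ℕ.+ r-num ℕ.* (suc j ℕ.* suc k) →
  (+ A ℤ.- + B) ℚ./ suc j ℚ.≤ (+ A′ ℤ.- + B′) ℚ./ suc k ℚ.+ r
fraction-≤ A B A′ B′ j k r n d r≃ hyp = ℚ.toℚᵘ-cancel-≤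
  (ℚᵘ.≤-respˡ-≃ (ℚᵘ.≃-sym (toℚᵘ-/ (+ A ℤ.- + B) j))
  (ℚᵘ.≤-respʳ-≃ (ℚᵘ.≃-sym (ℚᵘ.≃-trans (ℚ.toℚᵘ-homo-+ ((+ A′ ℤ.- + B′) ℚ./ suc k) r)
      (ℚᵘ.+-cong (toℚᵘ-/ (+ A′ ℤ.- + B′) k) r≃)))
  (ℚᵘ.*≤* (subst₂ ℤ._≤_ (eq₁ (+ A) (+ B) (+ B′) (+ suc j) (+ suc k) (+ suc d))
                        (eq₂ (+ A′) (+ B) (+ B′) (+ n) (+ suc j) (+ suc k) (+ suc d))
     (ℤ.+-monoˡ-≤ (ℤ.- (+ B′ ℤ.* (+ suc j ℤ.* + suc d) ℤ.+ + B ℤ.* (+ suc k ℤ.* + suc d))) hyp′)))))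
  where
  hyp′ : + A ℤ.* (+ suc k ℤ.* + suc d) ℤ.+ + B′ ℤ.* (+ suc j ℤ.* + suc d) ℤ.≤
         + A′ ℤ.* (+ suc j ℤ.* + suc d) ℤ.+ + B ℤ.* (+ suc k ℤ.* + suc d) ℤ.+ + n ℤ.* (+ suc j ℤ.* + suc k)
  hyp′ = subst₂ ℤ._≤_
    (cong₂ ℤ._+_ (ℤ.pos-* A _) (ℤ.pos-* B′ _))
    (cong₂ ℤ._+_ (cong₂ ℤ._+_ (ℤ.pos-* A′ _) (ℤ.pos-* B _)) (ℤ.pos-* n _))
    (ℤ.+≤+ hyp)
  eq₁ : ∀ A B B′ J K D → A ℤ.* (K ℤ.* D) ℤ.+ B′ ℤ.* (J ℤ.* D) ℤ.+ ℤ.- (B′ ℤ.* (J ℤ.* D) ℤ.+ B ℤ.* (K ℤ.* D)) ≡ (A ℤ.- B) ℤ.* (K ℤ.* D)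
  eq₁ = ℤ-Ring.solve-∀
  eq₂ : ∀ A′ B B′ n J K D → A′ ℤ.* (J ℤ.* D) ℤ.+ B ℤ.* (K ℤ.* D) ℤ.+ n ℤ.* (J ℤ.* K) ℤ.+ ℤ.- (B′ ℤ.* (J ℤ.* D) ℤ.+ B ℤ.* (K ℤ.* D))
        ≡ ((A′ ℤ.- B′) ℤ.* D ℤ.+ n ℤ.* K) ℤ.* J
  eq₂ = ℤ-Ring.solve-∀

log≈-gap : ℚ → ℚ
log≈-gap δ = + 1 ℚ./ (2 ℕ.* (3 ℕ.* ↧ₙ δ))

log≈-gap-positive : ∀ δ → 0ℚ ℚ.< log≈-gap δ
log≈-gap-positive δ = ℚ.positive⁻¹ (log≈-gap δ) {{ℚ.normalize-pos 1 (2 ℕ.* (3 ℕ.* ↧ₙ δ))}}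

log≈-close : ∀ {c δ x y} j k → 0ℚ ℚ.< c → 0ℚ ℚ.< δ → c ℚ.≤ x → c ℚ.≤ y →
  3 ℕ.* ↧ₙ δ ℕ.≤ j → 3 ℕ.* ↧ₙ δ ℕ.≤ k →
  x ℚ.≤ y ℚ.+ c ℚ.* log≈-gap δ → log≈ j x ℚ.≤ log≈ k y ℚ.+ δ
log≈-close {δ = mkℚ (+ zero) _ _} _ _ _ (ℚ.*<* (ℤ.+<+ ()))
log≈-close {δ = mkℚ ℤ.-[1+ _ ] _ _} _ _ _ (ℚ.*<* ())
log≈-close {c} {δ@(mkℚ +[1+ p ] d-1 _)} {x} {y} j k 0<c 0<δ c≤x c≤y h≤j h≤k hyp =
  fraction-≤ A B A′ B′ j k δ (suc p) d-1 ℚᵘ.≃-refl bound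
  where
  d = suc d-1
  h = 3 ℕ.* d
  J = suc j
  K = suc k
  A  = ⌊log₂ ℤ.∣ ↥ x ∣ ℕ.^ J ⌋
  B  = ⌊log₂ ↧ₙ x ℕ.^ J ⌋
  A′ = ⌊log₂ ℤ.∣ ↥ y ∣ ℕ.^ K ⌋
  B′ = ⌊log₂ ↧ₙ y ℕ.^ K ⌋
  0<x = ℚ.<-≤-trans 0<c c≤x
  0<y = ℚ.<-≤-trans 0<c c≤y
  open ℕ.≤-Reasoning
  e₁ : ∀ A B′ J K d → 3 ℕ.* (A ℕ.* (K ℕ.* d) ℕ.+ B′ ℕ.* (J ℕ.* d)) ≡ A ℕ.* (K ℕ.* (3 ℕ.* d)) ℕ.+ B′ ℕ.* (J ℕ.* (3 ℕ.* d))
  e₁ = ℕ-Ring.solve-∀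
  e₂ : ∀ A′ B J K h → J ℕ.* K ℕ.+ (suc A′ ℕ.* (J ℕ.* h) ℕ.+ suc B ℕ.* (K ℕ.* h)) ≡ A′ ℕ.* (J ℕ.* h) ℕ.+ B ℕ.* (K ℕ.* h) ℕ.+ (J ℕ.* K ℕ.+ J ℕ.* h ℕ.+ h ℕ.* K)
  e₂ = ℕ-Ring.solve-∀
  e₃ : ∀ A′ B J K d → A′ ℕ.* (J ℕ.* (3 ℕ.* d)) ℕ.+ B ℕ.* (K ℕ.* (3 ℕ.* d)) ℕ.+ (J ℕ.* K ℕ.+ J ℕ.* K ℕ.+ J ℕ.* K) ≡ 3 ℕ.* (A′ ℕ.* (J ℕ.* d) ℕ.+ B ℕ.* (K ℕ.* d) ℕ.+ 1 ℕ.* (J ℕ.* K))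
  e₃ = ℕ-Ring.solve-∀
  bound : A ℕ.* (K ℕ.* d) ℕ.+ B′ ℕ.* (J ℕ.* d) ℕ.≤ A′ ℕ.* (J ℕ.* d) ℕ.+ B ℕ.* (K ℕ.* d) ℕ.+ suc p ℕ.* (J ℕ.* K)
  bound = ℕ.*-cancelˡ-≤ 3 (begin
    3 ℕ.* (A ℕ.* (K ℕ.* d) ℕ.+ B′ ℕ.* (J ℕ.* d))  ≡⟨ e₁ A B′ J K d ⟩
    A ℕ.* (K ℕ.* h) ℕ.+ B′ ℕ.* (J ℕ.* h)          ≤⟨ ⌊log₂⌋-compare ℤ.∣ ↥ x ∣ (↧ₙ x) ℤ.∣ ↥ y ∣ (↧ₙ y) J K h {{num-nonZero 0<x}} (ratio h 0<x c≤y 0<y hyp) ⟩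
    J ℕ.* K ℕ.+ (suc A′ ℕ.* (J ℕ.* h) ℕ.+ suc B ℕ.* (K ℕ.* h)) ≡⟨ e₂ A′ B J K h ⟩
    A′ ℕ.* (J ℕ.* h) ℕ.+ B ℕ.* (K ℕ.* h) ℕ.+ (J ℕ.* K ℕ.+ J ℕ.* h ℕ.+ h ℕ.* K)
      ≤⟨ ℕ.+-monoʳ-≤ (A′ ℕ.* (J ℕ.* h) ℕ.+ B ℕ.* (K ℕ.* h)) (ℕ.+-mono-≤ (ℕ.+-monoʳ-≤ (J ℕ.* K) (ℕ.*-monoʳ-≤ J (ℕ.m≤n⇒m≤1+n h≤k))) (ℕ.*-monoˡ-≤ K (ℕ.m≤n⇒m≤1+n h≤j))) ⟩
    A′ ℕ.* (J ℕ.* h) ℕ.+ B ℕ.* (K ℕ.* h) ℕ.+ (J ℕ.* K ℕ.+ J ℕ.* K ℕ.+ J ℕ.* K) ≡⟨ e₃ A′ B J K d ⟩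
    3 ℕ.* (A′ ℕ.* (J ℕ.* d) ℕ.+ B ℕ.* (K ℕ.* d) ℕ.+ 1 ℕ.* (J ℕ.* K))
      ≤⟨ ℕ.*-monoʳ-≤ 3 (ℕ.+-monoʳ-≤ (A′ ℕ.* (J ℕ.* d) ℕ.+ B ℕ.* (K ℕ.* d)) (ℕ.*-monoˡ-≤ (J ℕ.* K) (ℕ.s≤s (ℕ.z≤n {p})))) ⟩
    3 ℕ.* (A′ ℕ.* (J ℕ.* d) ℕ.+ B ℕ.* (K ℕ.* d) ℕ.+ suc p ℕ.* (J ℕ.* K)) ∎)

log≈-lower : ∀ q p r k → 2 ℕ.^ p ℕ.* ↧ₙ q ℕ.^ suc r ℕ.≤ ℤ.∣ ↥ q ∣ ℕ.^ suc r →
  + p ℚ./ suc r ℚ.≤ log≈ k q ℚ.+ + 1 ℚ./ suc k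
log≈-lower q p r k hyp = subst (λ t → t ℚ./ suc r ℚ.≤ log≈ k q ℚ.+ + 1 ℚ./ suc k) (ℤ.+-identityʳ (+ p))
  (fraction-≤ p 0 A B r k (+ 1 ℚ./ suc k) 1 k (toℚᵘ-/ (+ 1) k) (begin
     p ℕ.* (K ℕ.* K) ℕ.+ B ℕ.* (R ℕ.* K)   ≡⟨ e₁ p B K R ⟩
     (p ℕ.* K ℕ.+ B ℕ.* R) ℕ.* K           ≤⟨ ℕ.*-monoˡ-≤ K (⌊log₂⌋-lower ℤ.∣ ↥ q ∣ (↧ₙ q) p R K hyp) ⟩
     suc A ℕ.* R ℕ.* K                     ≡⟨ e₂ A R K ⟩
     A ℕ.* (R ℕ.* K) ℕ.+ 0 ℕ.* (K ℕ.* K) ℕ.+ 1 ℕ.* (R ℕ.* K) ∎))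
  where
  open ℕ.≤-Reasoning
  K = suc k
  R = suc r
  A = ⌊log₂ ℤ.∣ ↥ q ∣ ℕ.^ K ⌋
  B = ⌊log₂ ↧ₙ q ℕ.^ K ⌋
  e₁ : ∀ p B K R → p ℕ.* (K ℕ.* K) ℕ.+ B ℕ.* (R ℕ.* K) ≡ (p ℕ.* K ℕ.+ B ℕ.* R) ℕ.* K
  e₁ = ℕ-Ring.solve-∀
  e₂ : ∀ A R K → suc A ℕ.* R ℕ.* K ≡ A ℕ.* (R ℕ.* K) ℕ.+ 0 ℕ.* (K ℕ.* K) ℕ.+ 1 ℕ.* (R ℕ.* K)
  e₂ = ℕ-Ring.solve-∀

log≈-upper : ∀ {q} p r k → 0ℚ ℚ.< q → ℤ.∣ ↥ q ∣ ℕ.^ suc r ℕ.≤ 2 ℕ.^ p ℕ.* ↧ₙ q ℕ.^ suc r →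
  log≈ k q ℚ.≤ + p ℚ./ suc r ℚ.+ + 1 ℚ./ suc k
log≈-upper {q} p r k 0<q hyp = subst (λ t → log≈ k q ℚ.≤ t ℚ./ suc r ℚ.+ + 1 ℚ./ suc k) (ℤ.+-identityʳ (+ p))
  (fraction-≤ A B p 0 k r (+ 1 ℚ./ suc k) 1 k (toℚᵘ-/ (+ 1) k) (begin
     A ℕ.* (R ℕ.* K) ℕ.+ 0 ℕ.* (K ℕ.* K)   ≡⟨ e₁ A R K ⟩
     A ℕ.* R ℕ.* K                         ≤⟨ ℕ.*-monoˡ-≤ K (⌊log₂⌋-upper ℤ.∣ ↥ q ∣ (↧ₙ q) p R K {{num-nonZero 0<q}} hyp) ⟩
     (p ℕ.* K ℕ.+ suc B ℕ.* R) ℕ.* K       ≡⟨ e₂ p B R K ⟩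
     p ℕ.* (K ℕ.* K) ℕ.+ B ℕ.* (R ℕ.* K) ℕ.+ 1 ℕ.* (K ℕ.* R) ∎))
  where
  open ℕ.≤-Reasoning
  K = suc k
  R = suc r
  A = ⌊log₂ ℤ.∣ ↥ q ∣ ℕ.^ K ⌋
  B = ⌊log₂ ↧ₙ q ℕ.^ K ⌋
  e₁ : ∀ A R K → A ℕ.* (R ℕ.* K) ℕ.+ 0 ℕ.* (K ℕ.* K) ≡ A ℕ.* R ℕ.* K
  e₁ = ℕ-Ring.solve-∀
  e₂ : ∀ p B R K → (p ℕ.* K ℕ.+ suc B ℕ.* R) ℕ.* K ≡ p ℕ.* (K ℕ.* K) ℕ.+ B ℕ.* (R ℕ.* K) ℕ.+ 1 ℕ.* (K ℕ.* R)
  e₂ = ℕ-Ring.solve-∀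

-- Cauchy sequences of rationals; equality of reals is _≃_ below, not _≡_.
IsCauchy : (ℕ → ℚ) → Set
IsCauchy x = ∀ {δ} → 0ℚ ℚ.< δ → ∃[ N ] (∀ {j k} → N ℕ.≤ j → N ℕ.≤ k → ℚ.∣ x j ℚ.- x k ∣ ℚ.≤ δ)

record ℝ : Set where
  constructor mkℝ
  field
    seq    : ℕ → ℚ
    cauchy : IsCauchy seq

open ℝ public

infix 4 _≤_ _<_ _≃_

record _≤_ (x y : ℝ) : Set where
  constructor *≤*
  field
    eventually : ∀ {δ} → 0ℚ ℚ.< δ → ∃[ N ] (∀ {k} → N ℕ.≤ k → seq x k ℚ.≤ seq y k ℚ.+ δ)

record _<_ (x y : ℝ) : Set where
  constructor *<*
  field
    {gap}        : ℚ
    gap-positive : 0ℚ ℚ.< gap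
    threshold    : ℕ
    separated    : ∀ {k} → threshold ℕ.≤ k → seq x k ℚ.+ gap ℚ.≤ seq y k

_≃_ : ℝ → ℝ → Set
x ≃ y = x ≤ y × y ≤ x

abstract
  const-cauchy : ∀ q → IsCauchy (λ _ → q)
  const-cauchy q {δ} 0<δ = 0 , λ _ _ → subst (ℚ._≤ δ) (cong ℚ.∣_∣ (sym (ℚ.+-inverseʳ q))) (ℚ.<⇒≤ 0<δ)

fromℚ : ℚ → ℝ
fromℚ q = mkℝ (λ _ → q) (const-cauchy q)

fromℕ : ℕ → ℝ
fromℕ n = fromℚ (+ n ℚ./ 1)

0ℝ 1ℝ : ℝ
0ℝ = fromℚ 0ℚ
1ℝ = fromℚ 1ℚ

infixl 6 _+_
infixl 7 _*_ _÷_[_]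

abstract
  +-cauchy : ∀ x y → IsCauchy (λ k → seq x k ℚ.+ seq y k)
  +-cauchy x y {δ} 0<δ =
    let N₁ , px = cauchy x (half-positive 0<δ)
        N₂ , py = cauchy y (half-positive 0<δ)
    in N₁ ℕ.⊔ N₂ , λ {j} {k} N≤j N≤k → begin
      ℚ.∣ (seq x j ℚ.+ seq y j) ℚ.- (seq x k ℚ.+ seq y k) ∣
        ≡⟨ cong ℚ.∣_∣ (solve 4 (λ a b c d → (a :+ b) :+ :- (c :+ d) := (a :+ :- c) :+ (b :+ :- d)) refl (seq x j) (seq y j) (seq x k) (seq y k)) ⟩
      ℚ.∣ (seq x j ℚ.- seq x k) ℚ.+ (seq y j ℚ.- seq y k) ∣
        ≤⟨ ℚ.∣p+q∣≤∣p∣+∣q∣ (seq x j ℚ.- seq x k) (seq y j ℚ.- seq y k) ⟩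
      ℚ.∣ seq x j ℚ.- seq x k ∣ ℚ.+ ℚ.∣ seq y j ℚ.- seq y k ∣
        ≤⟨ ℚ.+-mono-≤ (px (ℕ.m⊔n≤o⇒m≤o N₁ N₂ N≤j) (ℕ.m⊔n≤o⇒m≤o N₁ N₂ N≤k)) (py (ℕ.m⊔n≤o⇒n≤o N₁ N₂ N≤j) (ℕ.m⊔n≤o⇒n≤o N₁ N₂ N≤k)) ⟩
      ½ ℚ.* δ ℚ.+ ½ ℚ.* δ
        ≡⟨ half+half δ ⟩
      δ ∎
    where
    open ℚ.≤-Reasoning
    open +-*-Solver

_+_ : ℝ → ℝ → ℝ
x + y = mkℝ (λ k → seq x k ℚ.+ seq y k) (+-cauchy x y)

eventually-bounded : ∀ x → ∃[ B ] 0ℚ ℚ.< B × ∃[ N ] (∀ {k} → N ℕ.≤ k → ℚ.∣ seq x k ∣ ℚ.≤ B)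
eventually-bounded x =
  let N , p = cauchy x 0<1
  in ℚ.∣ seq x N ∣ ℚ.+ 1ℚ , ℚ.+-mono-≤-< (ℚ.0≤∣p∣ (seq x N)) 0<1 , N , λ {k} N≤k → begin
    ℚ.∣ seq x k ∣                             ≡⟨ cong ℚ.∣_∣ (solve 2 (λ a b → a := b :+ (a :+ :- b)) refl (seq x k) (seq x N)) ⟩
    ℚ.∣ seq x N ℚ.+ (seq x k ℚ.- seq x N) ∣   ≤⟨ ℚ.∣p+q∣≤∣p∣+∣q∣ (seq x N) (seq x k ℚ.- seq x N) ⟩
    ℚ.∣ seq x N ∣ ℚ.+ ℚ.∣ seq x k ℚ.- seq x N ∣ ≤⟨ ℚ.+-monoʳ-≤ ℚ.∣ seq x N ∣ (p N≤k ℕ.≤-refl) ⟩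
    ℚ.∣ seq x N ∣ ℚ.+ 1ℚ                      ∎
  where
  open ℚ.≤-Reasoning
  open +-*-Solver
  0<1 : 0ℚ ℚ.< 1ℚ
  0<1 = ℚ.positive⁻¹ 1ℚ

abstract
  *-cauchy : ∀ x y → IsCauchy (λ k → seq x k ℚ.* seq y k)
  *-cauchy x y {δ} 0<δ =
    let A , 0<A , N₁ , bx = eventually-bounded x
        B , 0<B , N₂ , by = eventually-bounded y
        N₃ , px = cauchy x (*-positive (half-positive 0<δ) (inv-positive 0<B))
        N₄ , py = cauchy y (*-positive (half-positive 0<δ) (inv-positive 0<A))
        M₁ = N₁ ℕ.⊔ N₂
        M₂ = N₃ ℕ.⊔ N₄
        l : ∀ {k} → M₁ ℕ.⊔ M₂ ℕ.≤ k → M₁ ℕ.≤ k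
        l = ℕ.m⊔n≤o⇒m≤o M₁ M₂
        r : ∀ {k} → M₁ ℕ.⊔ M₂ ℕ.≤ k → M₂ ℕ.≤ k
        r = ℕ.m⊔n≤o⇒n≤o M₁ M₂
    in M₁ ℕ.⊔ M₂ , λ {j} {k} M≤j M≤k → begin
      ℚ.∣ seq x j ℚ.* seq y j ℚ.- seq x k ℚ.* seq y k ∣
        ≤⟨ *-lipschitz {x = seq x j} {seq y j} {seq x k} {seq y k}
             (bx (ℕ.m⊔n≤o⇒m≤o N₁ N₂ (l M≤j))) (by (ℕ.m⊔n≤o⇒n≤o N₁ N₂ (l M≤k)))
             (px (ℕ.m⊔n≤o⇒m≤o N₃ N₄ (r M≤j)) (ℕ.m⊔n≤o⇒m≤o N₃ N₄ (r M≤k)))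
             (py (ℕ.m⊔n≤o⇒n≤o N₃ N₄ (r M≤j)) (ℕ.m⊔n≤o⇒n≤o N₃ N₄ (r M≤k))) ⟩
      A ℚ.* (½ ℚ.* δ ℚ.* inv A) ℚ.+ ½ ℚ.* δ ℚ.* inv B ℚ.* B
        ≡⟨ solve 5 (λ a i b j d → a :* (d :* i) :+ d :* j :* b := d :* (i :* a) :+ d :* (j :* b)) refl A (inv A) B (inv B) (½ ℚ.* δ) ⟩
      ½ ℚ.* δ ℚ.* (inv A ℚ.* A) ℚ.+ ½ ℚ.* δ ℚ.* (inv B ℚ.* B)
        ≡⟨ cong₂ (λ s t → ½ ℚ.* δ ℚ.* s ℚ.+ ½ ℚ.* δ ℚ.* t) (inv-inverse 0<A) (inv-inverse 0<B) ⟩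
      ½ ℚ.* δ ℚ.* 1ℚ ℚ.+ ½ ℚ.* δ ℚ.* 1ℚ
        ≡⟨ cong₂ ℚ._+_ (ℚ.*-identityʳ (½ ℚ.* δ)) (ℚ.*-identityʳ (½ ℚ.* δ)) ⟩
      ½ ℚ.* δ ℚ.+ ½ ℚ.* δ
        ≡⟨ half+half δ ⟩
      δ ∎
    where
    open ℚ.≤-Reasoning
    open +-*-Solver

_*_ : ℝ → ℝ → ℝ
x * y = mkℝ (λ k → seq x k ℚ.* seq y k) (*-cauchy x y)

eventually-≥ : ∀ {y} (0<y : 0ℝ < y) → ∀ {k} → _<_.threshold 0<y ℕ.≤ k → _<_.gap 0<y ℚ.≤ seq y k
eventually-≥ {y} (*<* {c} _ _ p) {k} N≤k = subst (ℚ._≤ seq y k) (ℚ.+-identityˡ c) (p N≤k)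

abstract
  inv-cauchy : ∀ y → 0ℝ < y → IsCauchy (λ k → inv (seq y k))
  inv-cauchy y 0<y@(*<* {c} 0<c N₁ _) {δ} 0<δ =
    let N₂ , py = cauchy y (*-positive 0<δ (*-positive 0<c 0<c))
    in N₁ ℕ.⊔ N₂ , λ {j} {k} N≤j N≤k → inv-lipschitz 0<c (ℚ.<⇒≤ 0<δ)
         (eventually-≥ 0<y (ℕ.m⊔n≤o⇒m≤o N₁ N₂ N≤j)) (eventually-≥ 0<y (ℕ.m⊔n≤o⇒m≤o N₁ N₂ N≤k))
         (py (ℕ.m⊔n≤o⇒n≤o N₁ N₂ N≤j) (ℕ.m⊔n≤o⇒n≤o N₁ N₂ N≤k))

reciprocal : (y : ℝ) → 0ℝ < y → ℝ
reciprocal y 0<y = mkℝ (λ k → inv (seq y k)) (inv-cauchy y 0<y)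

_÷_[_] : (x y : ℝ) → 0ℝ < y → ℝ
x ÷ y [ 0<y ] = x * reciprocal y 0<y

abstract
  log₂-cauchy : ∀ x → 0ℝ < x → IsCauchy (λ k → log≈ k (seq x k))
  log₂-cauchy x 0<x@(*<* {c} 0<c N₁ _) {δ} 0<δ =
    let N₂ , px = cauchy x (*-positive 0<c (log≈-gap-positive δ))
        M₁ = N₁ ℕ.⊔ N₂
        M₂ = 3 ℕ.* ↧ₙ δ
        close : ∀ {j k} → M₁ ℕ.⊔ M₂ ℕ.≤ j → M₁ ℕ.⊔ M₂ ℕ.≤ k → log≈ j (seq x j) ℚ.≤ log≈ k (seq x k) ℚ.+ δ
        close = λ {j} {k} M≤j M≤k →
          let M₁≤j = ℕ.m⊔n≤o⇒m≤o M₁ M₂ M≤j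
              M₁≤k = ℕ.m⊔n≤o⇒m≤o M₁ M₂ M≤k
          in log≈-close j k 0<c 0<δ
               (eventually-≥ 0<x (ℕ.m⊔n≤o⇒m≤o N₁ N₂ M₁≤j)) (eventually-≥ 0<x (ℕ.m⊔n≤o⇒m≤o N₁ N₂ M₁≤k))
               (ℕ.m⊔n≤o⇒n≤o M₁ M₂ M≤j) (ℕ.m⊔n≤o⇒n≤o M₁ M₂ M≤k)
               (∣x-y∣≤⇒x≤y+ {seq x j} {seq x k} (px (ℕ.m⊔n≤o⇒n≤o N₁ N₂ M₁≤j) (ℕ.m⊔n≤o⇒n≤o N₁ N₂ M₁≤k)))
    in M₁ ℕ.⊔ M₂ , λ M≤j M≤k → ≤+⇒∣x-y∣≤ (close M≤j M≤k) (close M≤k M≤j)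

log₂ : (x : ℝ) → 0ℝ < x → ℝ
log₂ x 0<x = mkℝ (λ k → log≈ k (seq x k)) (log₂-cauchy x 0<x)

_⟶0 : (ℕ → ℝ) → Set
ε ⟶0 = ∀ {δ} → 0ℚ ℚ.< δ → ∃[ N ] (∀ {n} → N ℕ.≤ n → fromℚ (ℚ.- δ) ≤ ε n × ε n ≤ fromℚ δ)

n/1≡ : ∀ n → + n ℚ./ 1 ≡ mkℚ (+ n) 0 (coprime-sym (1-coprimeTo n))
n/1≡ n = ℚ.↥p/↧p≡p (mkℚ (+ n) 0 (coprime-sym (1-coprimeTo n)))

log≈-≥ : ∀ q p r k K {c} → K ℕ.≤ k → + p ℚ./ suc r ≡ c ℚ.+ + 1 ℚ./ suc K →
  2 ℕ.^ p ℕ.* ↧ₙ q ℕ.^ suc r ℕ.≤ ℤ.∣ ↥ q ∣ ℕ.^ suc r → c ℚ.≤ log≈ k q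
log≈-≥ q p r k K {c} K≤k eq hyp = begin
  c                                                        ≡⟨ solve 2 (λ c i → c := (c :+ i) :+ :- i) refl c (+ 1 ℚ./ suc K) ⟩
  (c ℚ.+ + 1 ℚ./ suc K) ℚ.- + 1 ℚ./ suc K                  ≡⟨ cong (ℚ._- + 1 ℚ./ suc K) eq ⟨
  + p ℚ./ suc r ℚ.- + 1 ℚ./ suc K                          ≤⟨ ℚ.+-mono-≤ (log≈-lower q p r k hyp) (ℚ.neg-antimono-≤ 1/k≤1/K) ⟩
  (log≈ k q ℚ.+ + 1 ℚ./ suc k) ℚ.- + 1 ℚ./ suc k           ≡⟨ solve 2 (λ l i → (l :+ i) :+ :- i := l) refl (log≈ k q) (+ 1 ℚ./ suc k) ⟩
  log≈ k q                                                 ∎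
  where
  open ℚ.≤-Reasoning
  open +-*-Solver
  1/k≤1/K : + 1 ℚ./ suc k ℚ.≤ + 1 ℚ./ suc K
  1/k≤1/K = ℚ.toℚᵘ-cancel-≤ (ℚᵘ.≤-respˡ-≃ (ℚᵘ.≃-sym (toℚᵘ-/ (+ 1) k)) (ℚᵘ.≤-respʳ-≃ (ℚᵘ.≃-sym (toℚᵘ-/ (+ 1) K))
    (ℚᵘ.*≤* (ℤ.*-monoˡ-≤-nonNeg (+ 1) (ℤ.+≤+ (ℕ.s≤s K≤k))))))

log≈n≥5/4 : ∀ {n k} → 3 ℕ.≤ n → 3 ℕ.≤ k → + 5 ℚ./ 4 ℚ.≤ log≈ k (+ n ℚ./ 1)
log≈n≥5/4 {n} {k} 3≤n 3≤k rewrite n/1≡ n = log≈-≥ (mkℚ (+ n) 0 (coprime-sym (1-coprimeTo n))) 3 1 k 3 3≤k refl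
  (ℕ.≤-trans (ℕ.n≤1+n 8) (ℕ.^-monoˡ-≤ 2 3≤n))

log≈q≥1/8 : ∀ {q k} → + 5 ℚ./ 4 ℚ.≤ q → 7 ℕ.≤ k → + 1 ℚ./ 8 ℚ.≤ log≈ k q
log≈q≥1/8 {mkℚ ℤ.-[1+ _ ] _ _} (ℚ.*≤* ())
log≈q≥1/8 {q@(mkℚ (+ a) b-1 _)} {k} (ℚ.*≤* le) 7≤k = log≈-≥ q 1 3 k 7 7≤k refl
  (ℕ.*-cancelʳ-≤ (2 ℕ.* b ℕ.^ 4) (a ℕ.^ 4) 256 (begin
    2 ℕ.* b ℕ.^ 4 ℕ.* 256  ≡⟨ e₁ (b ℕ.^ 4) ⟩
    512 ℕ.* b ℕ.^ 4        ≤⟨ ℕ.*-monoˡ-≤ (b ℕ.^ 4) (ℕ.m≤m+n 512 113) ⟩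
    5 ℕ.^ 4 ℕ.* b ℕ.^ 4    ≡⟨ ^-distribʳ-* 5 b 4 ⟨
    (5 ℕ.* b) ℕ.^ 4        ≤⟨ ℕ.^-monoˡ-≤ 4 5b≤a4 ⟩
    (a ℕ.* 4) ℕ.^ 4        ≡⟨ ^-distribʳ-* a 4 4 ⟩
    a ℕ.^ 4 ℕ.* 256        ∎))
  where
  open ℕ.≤-Reasoning
  b = suc b-1
  5b≤a4 : 5 ℕ.* b ℕ.≤ a ℕ.* 4
  5b≤a4 = ℤ.drop‿+≤+ (subst (+ 5 ℤ.* + b ℤ.≤_) (sym (ℤ.pos-* a 4)) le)
  e₁ : ∀ x → 2 ℕ.* x ℕ.* 256 ≡ 512 ℕ.* x
  e₁ x = trans (ℕ.*-assoc 2 x 256) (trans (cong (2 ℕ.*_) (ℕ.*-comm x 256)) (sym (ℕ.*-assoc 2 256 x)))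

fromℕ-positive : ∀ {n} → 1 ℕ.≤ n → 0ℝ < fromℕ n
fromℕ-positive {n} 1≤n = *<* (ℚ.positive⁻¹ 1ℚ) 0 λ _ → subst (0ℚ ℚ.+ 1ℚ ℚ.≤_) (sym (n/1≡ n))
  (ℚ.*≤* (ℤ.*-monoʳ-≤-nonNeg (+ 1) (ℤ.+≤+ 1≤n)))

log : (n : ℕ) → 3 ℕ.≤ n → ℝ
log n 3≤n = log₂ (fromℕ n) (fromℕ-positive (ℕ.≤-trans (ℕ.m≤m+n 1 2) 3≤n))

log-positive : ∀ {n} (3≤n : 3 ℕ.≤ n) → 0ℝ < log n 3≤n
log-positive 3≤n = *<* (ℚ.positive⁻¹ (+ 5 ℚ./ 4)) 3 λ {k} 3≤k → log≈n≥5/4 {k = k} 3≤n 3≤k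

log-log : (n : ℕ) → 3 ℕ.≤ n → ℝ
log-log n 3≤n = log₂ (log n 3≤n) (log-positive 3≤n)

log-log-positive : ∀ {n} (3≤n : 3 ℕ.≤ n) → 0ℝ < log-log n 3≤n
log-log-positive 3≤n = *<* (ℚ.positive⁻¹ (+ 1 ℚ./ 8)) 7 λ {k} 7≤k →
  log≈q≥1/8 {k = k} (log≈n≥5/4 {k = k} 3≤n (ℕ.≤-trans (ℕ.m≤m+n 3 4) 7≤k)) 7≤k

*-positiveᴿ : ∀ {x y} → 0ℝ < x → 0ℝ < y → 0ℝ < x * y
*-positiveᴿ {x} {y} 0<x@(*<* {c} 0<c N₁ _) 0<y@(*<* {d} 0<d N₂ _) =
  *<* (*-positive 0<c 0<d) (N₁ ℕ.⊔ N₂) λ {k} N≤k → begin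
    0ℚ ℚ.+ c ℚ.* d         ≡⟨ ℚ.+-identityˡ (c ℚ.* d) ⟩
    c ℚ.* d                ≤⟨ ℚ.*-monoˡ-≤-nonNeg c {{ℚ.nonNegative (ℚ.<⇒≤ 0<c)}} (eventually-≥ 0<y (ℕ.m⊔n≤o⇒n≤o N₁ N₂ N≤k)) ⟩
    c ℚ.* seq y k          ≤⟨ ℚ.*-monoʳ-≤-nonNeg (seq y k)
                                {{ℚ.nonNegative (ℚ.≤-trans (ℚ.<⇒≤ 0<d) (eventually-≥ 0<y (ℕ.m⊔n≤o⇒n≤o N₁ N₂ N≤k)))}}
                                (eventually-≥ 0<x (ℕ.m⊔n≤o⇒m≤o N₁ N₂ N≤k)) ⟩
    seq x k ℚ.* seq y k    ∎
  where open ℚ.≤-Reasoning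

n*log-log-positive : ∀ {n} (3≤n : 3 ℕ.≤ n) → 0ℝ < fromℕ n * log-log n 3≤n
n*log-log-positive {n} 3≤n = *-positiveᴿ {fromℕ n} {log-log n 3≤n}
  (fromℕ-positive (ℕ.≤-trans (ℕ.m≤m+n 1 2) 3≤n)) (log-log-positive 3≤n)

permutations : ∀ n → List (Permutation′ n)
permutations zero    = [ idₚ ]
permutations (suc n) = cartesianProductWith (insert Fin.zero) (allFin (suc n)) (permutations n)

length-cartesianProductWith : ∀ {A B C : Set} (f : A → B → C) xs ys →
  length (cartesianProductWith f xs ys) ≡ length xs ℕ.* length ys
length-cartesianProductWith f []       ys = refl
length-cartesianProductWith f (x ∷ xs) ys = trans (length-++ (map (f x) ys))
  (cong₂ ℕ._+_ (length-map (f x) ys) (length-cartesianProductWith f xs ys))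

length-permutations : ∀ n → length (permutations n) ≡ n !
length-permutations zero    = refl
length-permutations (suc n) = trans
  (length-cartesianProductWith (insert Fin.zero) (allFin (suc n)) (permutations n))
  (cong₂ ℕ._*_ (length-tabulate {n = suc n} (λ i → i)) (length-permutations n))

permutations-complete : ∀ {n} (σ : Permutation′ n) → Any (σ ≈_) (permutations n)
permutations-complete {zero}  σ = here λ ()
permutations-complete {suc n} σ = Any.cartesianProductWith⁺ (insert Fin.zero) insert-≈
  (∈-allFin (σ ⟨$⟩ʳ Fin.zero)) (permutations-complete (remove Fin.zero σ))
  where
  insert-≈ : ∀ {j τ} → σ ⟨$⟩ʳ Fin.zero ≡ j → remove Fin.zero σ ≈ τ → σ ≈ insert Fin.zero j τ
  insert-≈ {τ = τ} refl eq i = trans (sym (insert-remove Fin.zero σ i)) (insert-cong i)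
    where
    insert-cong : insert Fin.zero (σ ⟨$⟩ʳ Fin.zero) (remove Fin.zero σ) ≈ insert Fin.zero (σ ⟨$⟩ʳ Fin.zero) τ
    insert-cong i with Fin.zero Fin.≟ i
    ... | yes _ = refl
    ... | no 0≢i = cong (Fin.punchIn (σ ⟨$⟩ʳ Fin.zero)) (eq (Fin.punchOut 0≢i))

record Strategy (n : ℕ) : Set where
  field
    hint      : Permutation′ n → Fin n
    -- Permutation′ carries proofs, so a function of σ as a mapping must respect _≈_.
    hint-cong : ∀ {σ τ} → σ ≈ τ → hint σ ≡ hint τ
    index     : Fin n → Fin n → Fin n

open Strategy public

Success : ∀ {n} → Strategy n → Permutation′ n × Fin n → Set
Success S (σ , s) = σ ⟨$⟩ʳ index S (hint S σ) s ≡ s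

success? : ∀ {n} (S : Strategy n) → Decidable (Success S)
success? S (σ , s) = σ ⟨$⟩ʳ index S (hint S σ) s Fin.≟ s

inputs : ∀ n → List (Permutation′ n × Fin n)
inputs n = cartesianProduct (permutations n) (allFin n)

length-inputs : ∀ n → length (inputs n) ≡ n ! ℕ.* n
length-inputs n = trans (length-cartesianProductWith _,_ (permutations n) (allFin n))
  (cong₂ ℕ._*_ (length-permutations n) (length-tabulate {n = n} (λ i → i)))

inputs-nonEmpty : ∀ n → .{{ℕ.NonZero n}} → ℕ.NonZero (length (inputs n))
inputs-nonEmpty n = subst ℕ.NonZero (sym (length-inputs n)) (ℕ.m*n≢0 (n !) n {{n ℕ.!≢0}})

-- Success probability for (σ , s) uniform on S_n × {0, …, n-1}.
Pr[_] : ∀ {n} .{{_ : ℕ.NonZero n}} → Strategy n → ℚ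
Pr[_] {n} S = (+ length (filter (success? S) (inputs n)) ℚ./ length (inputs n)) {{inputs-nonEmpty n}}

∑ : List ℝ → ℝ
∑ = foldr _+_ 0ℝ

-- There are finitely many deterministic strategies on {0, …, n-1}, so finite support is no restriction.
record RandomizedStrategy (n : ℕ) : Set where
  field
    support     : List (ℝ × Strategy n)
    nonNegative : All (λ (w , _) → 0ℝ ≤ w) support
    total       : ∑ (map proj₁ support) ≃ 1ℝ

open RandomizedStrategy public

Prᴿ[_] : ∀ {n} .{{_ : ℕ.NonZero n}} → RandomizedStrategy n → ℝ
Prᴿ[ D ] = ∑ (map (λ (w , S) → w * fromℚ Pr[ S ]) (support D))

{-# OPTIONS --safe #-}

-- For a fixed hint v let X v σ be the number of s with σ (i (v , s)) = s. The t-th falling factorial moment of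
-- X v over all permutations is at most 1, and x ≤ t - 1 + x (x - 1) ⋯ (x - t + 1) / t ! for every x.
-- Summing the moment over the n possible hints, a strategy finds on average at most t - 1 + n / t ! ≤ t of
-- the n numbers as soon as t ! ≥ n. With L = ⌊log n⌋, l = ⌊log L⌋ and m = ⌊log l⌋ one can take
-- t = s + r with s = 2 ^ (l - 2m + 1) and r ≈ L / (l - 2m + 1), since t ! ≥ s ^ r, and this t is at most
-- (1 + 18 / (m + 1)) L / (l + 1). As log n ≥ L and log log n ≤ l + 1, o(1) can be 18 / (m + 1).
module Submission where

-- Counting the inputs on which a strategy succeeds.

module Counting where

  open import Data.Bool using (if_then_else_)
  open import Data.Fin as Fin using (Fin; toℕ)
  open import Data.Fin.Permutation using (Permutation′; _⟨$⟩ʳ_; insert; insert-punchIn)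
  open import Data.Fin.Properties using (toℕ-injective)
  open import Data.List as List using (List; []; _∷_; length; filter; allFin; cartesianProductWith)
  open import Data.List.Properties using (map-∘; map-++; map-cong)
  open import Data.Nat
  open import Data.Nat.ListAction using () renaming (sum to sumₗ)
  open import Data.Nat.ListAction.Properties using (sum-++)
  open import Data.Nat.Properties
  import Data.Nat.Tactic.RingSolver as ℕ-Ring
  open import Data.Product using (_,_)
  open import Data.Vec.Functional using (removeAt)
  open import Function using (_∘_; _⇔_; mk⇔; Injection)
  open import Function.Properties.Inverse using (↔⇒↣)
  open import Level using (0ℓ)
  open import Relation.Binary.PropositionalEquality using (_≡_; refl; sym; trans; cong; cong₂; subst; _≗_; module ≡-Reasoning)
  open import Relation.Nullary using (Dec; yes; no; does; contradiction)
  open import Relation.Nullary.Decidable using (does-⇔)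
  open import Relation.Unary using (Decidable; Pred)
  open import Defs using (permutations; length-permutations; Strategy; hint; index; success?; inputs)
  open import Algebra.Properties.Semiring.Sum +-*-semiring

  -- Falling factorials and factorials.

  infixl 8 _↓_
  -- The falling factorial x (x - 1) ⋯ (x - t + 1), which is 0 once t exceeds x.
  _↓_ : ℕ → ℕ → ℕ
  x     ↓ zero  = 1
  zero  ↓ suc t = 0
  suc x ↓ suc t = suc x * x ↓ t

  ↓-monoˡ-≤ : ∀ t {x y} → x ≤ y → x ↓ t ≤ y ↓ t
  ↓-monoˡ-≤ zero    x≤y       = ≤-refl
  ↓-monoˡ-≤ (suc t) z≤n       = z≤n
  ↓-monoˡ-≤ (suc t) (s≤s x≤y) = *-mono-≤ (s≤s x≤y) (↓-monoˡ-≤ t x≤y)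

  -- This is `x ↓ suc t` = (x - t) * `x ↓ t` with the subtraction moved across.
  x*↓≡↓+t*↓ : ∀ x t → x * x ↓ t ≡ x ↓ suc t + t * x ↓ t
  x*↓≡↓+t*↓ zero    zero    = refl
  x*↓≡↓+t*↓ zero    (suc t) = sym (*-zeroʳ t)
  x*↓≡↓+t*↓ (suc x) zero    = sym (+-identityʳ _)
  x*↓≡↓+t*↓ (suc x) (suc t) = trans (e₁ x (x ↓ t)) (trans
    (cong (λ u → suc x * u + suc x * x ↓ t) (x*↓≡↓+t*↓ x t)) (e₂ x (x ↓ suc t) (x ↓ t) t))
    where
    e₁ : ∀ x u → suc x * (suc x * u) ≡ suc x * (x * u) + suc x * u
    e₁ = ℕ-Ring.solve-∀
    e₂ : ∀ x v u t → suc x * (v + t * u) + suc x * u ≡ suc x * v + suc t * (suc x * u)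
    e₂ = ℕ-Ring.solve-∀

  -- Pascal's rule multiplied by (t + 1)!.
  suc-↓ : ∀ x t → suc x ↓ suc t ≡ x ↓ suc t + suc t * x ↓ t
  suc-↓ x t = trans (cong (x ↓ t +_) (x*↓≡↓+t*↓ x t)) (e (x ↓ t) (x ↓ suc t) t)
    where
    e : ∀ u v t → u + (v + t * u) ≡ v + suc t * u
    e = ℕ-Ring.solve-∀

  *-pred-↓ : ∀ x t → x * pred x ↓ t ≡ x ↓ suc t
  *-pred-↓ zero    t = refl
  *-pred-↓ (suc x) t = refl

  -- The left side consists of the first two terms of Vandermonde's expansion of the right one.
  -- Applying Pascal's rule a times yields it directly.
  +-↓ : ∀ a b t → b ↓ suc t + a * (suc t * b ↓ t) ≤ (a + b) ↓ suc t
  +-↓ zero    b t = ≤-reflexive (+-identityʳ _)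
  +-↓ (suc a) b t = begin
    b ↓ suc t + suc a * (suc t * b ↓ t)             ≡⟨ e (b ↓ suc t) a (suc t * b ↓ t) ⟩
    b ↓ suc t + a * (suc t * b ↓ t) + suc t * b ↓ t ≤⟨ +-mono-≤ (+-↓ a b t) (*-monoʳ-≤ (suc t) (↓-monoˡ-≤ t (m≤n+m b a))) ⟩
    (a + b) ↓ suc t + suc t * (a + b) ↓ t           ≡⟨ suc-↓ (a + b) t ⟨
    (suc a + b) ↓ suc t                             ∎
    where
    open ≤-Reasoning
    e : ∀ u a v → u + suc a * v ≡ u + a * v + v
    e = ℕ-Ring.solve-∀

  !≤↓ : ∀ t d → t ! ≤ (t + d) ↓ t
  !≤↓ zero    d = ≤-refl
  !≤↓ (suc t) d = *-mono-≤ (s≤s (m≤m+n t d)) (!≤↓ t d)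

  -- After division by (t + 1)! the right side is a binomial coefficient, and each step of Pascal's
  -- rule in d raises it by at least one.
  !*≤↓ : ∀ t d → suc t ! * suc d ≤ (suc t + d) ↓ suc t
  !*≤↓ t zero    = ≤-trans (≤-reflexive (*-identityʳ _)) (!≤↓ (suc t) 0)
  !*≤↓ t (suc d) = begin
    suc t ! * suc (suc d)                            ≡⟨ e (suc t) (t !) (suc d) ⟩
    suc t ! * suc d + suc t * t !                    ≤⟨ +-mono-≤ (!*≤↓ t d) (*-monoʳ-≤ (suc t) (subst (λ u → t ! ≤ u ↓ t) (+-suc t d) (!≤↓ t (suc d)))) ⟩
    (suc t + d) ↓ suc t + suc t * (suc t + d) ↓ t    ≡⟨ suc-↓ (suc t + d) t ⟨
    (suc (suc t + d)) ↓ suc t                        ≡⟨ cong (_↓ suc t) (+-suc (suc t) d) ⟨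
    (suc t + suc d) ↓ suc t                          ∎
    where
    open ≤-Reasoning
    e : ∀ a b d → a * b * suc d ≡ a * b * d + a * b
    e = ℕ-Ring.solve-∀

  -- Turns a bound on a factorial moment into one on the mean. For x ≤ t the first summand suffices;
  -- beyond that, the binomial coefficient `x ↓ suc t` / (t + 1)! is at least x - t.
  !*x≤!*t+↓ : ∀ t x → suc t ! * x ≤ suc t ! * t + x ↓ suc t
  !*x≤!*t+↓ t x with x ≤? t
  ... | yes x≤t = ≤-trans (*-monoʳ-≤ (suc t !) x≤t) (m≤m+n _ _)
  ... | no x≰t = begin
    suc t ! * x                                 ≡⟨ cong (suc t ! *_) (m+[n∸m]≡n (≰⇒> x≰t)) ⟨
    suc t ! * (suc t + d)                       ≡⟨ e (suc t !) t d ⟩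
    suc t ! * t + suc t ! * suc d               ≤⟨ +-monoʳ-≤ (suc t ! * t) (!*≤↓ t d) ⟩
    suc t ! * t + (suc t + d) ↓ suc t           ≡⟨ cong (λ y → suc t ! * t + y ↓ suc t) (m+[n∸m]≡n (≰⇒> x≰t)) ⟩
    suc t ! * t + x ↓ suc t                     ∎
    where
    open ≤-Reasoning
    d = x ∸ suc t
    e : ∀ f t d → f * (suc t + d) ≡ f * t + f * suc d
    e = ℕ-Ring.solve-∀

  -- (n - t)!, or 0 when t > n
  [_-_]! : ℕ → ℕ → ℕ
  [ n     - zero  ]! = n !
  [ zero  - suc t ]! = 0
  [ suc n - suc t ]! = [ n - t ]!

  -- This is (n - t) (n - t - 1)! = (n - t)! without subtraction. It is strict only at t = n, where
  -- the left side is 0 but `[ n - t ]!` is 1.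
  n*[n-1+t]!≤ : ∀ n t → n * [ n - suc t ]! ≤ [ n - t ]! + t * [ n - suc t ]!
  n*[n-1+t]!≤ zero    t       = z≤n
  n*[n-1+t]!≤ (suc n) zero    = ≤-reflexive (sym (+-identityʳ _))
  n*[n-1+t]!≤ (suc n) (suc t) = begin
    [ n - suc t ]! + n * [ n - suc t ]!                ≤⟨ +-monoʳ-≤ [ n - suc t ]! (n*[n-1+t]!≤ n t) ⟩
    [ n - suc t ]! + ([ n - t ]! + t * [ n - suc t ]!) ≡⟨ e [ n - suc t ]! [ n - t ]! t ⟩
    [ n - t ]! + suc t * [ n - suc t ]!                ∎
    where
    open ≤-Reasoning
    e : ∀ p q t → p + (q + t * p) ≡ q + suc t * p
    e = ℕ-Ring.solve-∀

  ↓*[-]!≤! : ∀ n t → n ↓ t * [ n - t ]! ≤ n !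
  ↓*[-]!≤! n       zero    = ≤-reflexive (+-identityʳ _)
  ↓*[-]!≤! zero    (suc t) = z≤n
  ↓*[-]!≤! (suc n) (suc t) = ≤-trans (≤-reflexive (*-assoc (suc n) (n ↓ t) _)) (*-monoʳ-≤ (suc n) (↓*[-]!≤! n t))

  -- Indicators and finite sums.

  𝟙 : ∀ {P : Set} → Dec P → ℕ
  𝟙 d = if does d then 1 else 0

  𝟙-⇔ : ∀ {P Q : Set} (d : Dec P) (e : Dec Q) → P ⇔ Q → 𝟙 d ≡ 𝟙 e
  𝟙-⇔ d e eq = cong (if_then 1 else 0) (does-⇔ eq d e)

  sum-mono-≤ : ∀ {n} {f g : Fin n → ℕ} → (∀ i → f i ≤ g i) → sum f ≤ sum g
  sum-mono-≤ {zero}  f≤g = z≤n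
  sum-mono-≤ {suc n} f≤g = +-mono-≤ (f≤g Fin.zero) (sum-mono-≤ (f≤g ∘ Fin.suc))

  sum-const : ∀ n c → sum {n} (λ _ → c) ≡ n * c
  sum-const zero    c = refl
  sum-const (suc n) c = cong (c +_) (sum-const n c)

  sum-≥ : ∀ {n} (f : Fin n → ℕ) i → f i ≤ sum f
  sum-≥ {suc n} f i = ≤-trans (m≤m+n (f i) _) (≤-reflexive (sym (sum-remove {i = i} f)))

  ∑∈ : ∀ {A : Set} → List A → (A → ℕ) → ℕ
  ∑∈ xs f = sumₗ (List.map f xs)

  module _ {A : Set} where

    ∑∈-cong : ∀ (xs : List A) {f g} → f ≗ g → ∑∈ xs f ≡ ∑∈ xs g
    ∑∈-cong xs f≗g = cong sumₗ (map-cong f≗g xs)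

    ∑∈-mono-≤ : ∀ (xs : List A) {f g} → (∀ x → f x ≤ g x) → ∑∈ xs f ≤ ∑∈ xs g
    ∑∈-mono-≤ []       f≤g = z≤n
    ∑∈-mono-≤ (x ∷ xs) f≤g = +-mono-≤ (f≤g x) (∑∈-mono-≤ xs f≤g)

    ∑∈-distrib-+ : ∀ (xs : List A) f g → ∑∈ xs (λ x → f x + g x) ≡ ∑∈ xs f + ∑∈ xs g
    ∑∈-distrib-+ []       f g = refl
    ∑∈-distrib-+ (x ∷ xs) f g = trans (cong (f x + g x +_) (∑∈-distrib-+ xs f g)) (e (f x) (g x) (∑∈ xs f) (∑∈ xs g))
      where
      e : ∀ a b c d → a + b + (c + d) ≡ a + c + (b + d)
      e = ℕ-Ring.solve-∀

    *-distribˡ-∑∈ : ∀ c (xs : List A) f → c * ∑∈ xs f ≡ ∑∈ xs (λ x → c * f x)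
    *-distribˡ-∑∈ c []       f = *-zeroʳ c
    *-distribˡ-∑∈ c (x ∷ xs) f = trans (*-distribˡ-+ c (f x) _) (cong (c * f x +_) (*-distribˡ-∑∈ c xs f))

    ∑∈-const : ∀ (xs : List A) c → ∑∈ xs (λ _ → c) ≡ length xs * c
    ∑∈-const []       c = refl
    ∑∈-const (x ∷ xs) c = cong (c +_) (∑∈-const xs c)

    ∑∈-sum-comm : ∀ {n} (xs : List A) (f : A → Fin n → ℕ) →
      ∑∈ xs (λ x → sum (f x)) ≡ sum (λ i → ∑∈ xs (λ x → f x i))
    ∑∈-sum-comm {n} []       f = sym (sum-replicate-zero n)
    ∑∈-sum-comm (x ∷ xs) f = trans (cong (sum (f x) +_) (∑∈-sum-comm xs f)) (sym (∑-distrib-+ (f x) _))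

    length-filter-∑∈ : ∀ {P : Pred A 0ℓ} (P? : Decidable P) xs → length (filter P? xs) ≡ ∑∈ xs (λ x → 𝟙 (P? x))
    length-filter-∑∈ P? []       = refl
    length-filter-∑∈ P? (x ∷ xs) with P? x
    ... | yes _ = cong suc (length-filter-∑∈ P? xs)
    ... | no  _ = length-filter-∑∈ P? xs

    ∑∈-cartesianProductWith : ∀ {B C : Set} (h : A → B → C) xs ys (f : C → ℕ) →
      ∑∈ (cartesianProductWith h xs ys) f ≡ ∑∈ xs (λ x → ∑∈ ys (λ y → f (h x y)))
    ∑∈-cartesianProductWith h []       ys f = refl
    ∑∈-cartesianProductWith h (x ∷ xs) ys f = trans
      (cong sumₗ (map-++ f (List.map (h x) ys) _))
      (trans (sum-++ (List.map f (List.map (h x) ys)) _)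
        (cong₂ _+_ (cong sumₗ (sym (map-∘ ys))) (∑∈-cartesianProductWith h xs ys f)))

  ∑∈-tabulate : ∀ {n} {A : Set} (g : Fin n → A) (f : A → ℕ) → ∑∈ (List.tabulate g) f ≡ sum (f ∘ g)
  ∑∈-tabulate {zero}  g f = refl
  ∑∈-tabulate {suc n} g f = cong (f (g Fin.zero) +_) (∑∈-tabulate (g ∘ Fin.suc) f)

  -- Splits off the value j at position 0, for the induction on n in `∑-hits-↓`.
  ∑∈-permutations-suc : ∀ {n} (f : Permutation′ (suc n) → ℕ) →
    ∑∈ (permutations (suc n)) f ≡ sum (λ j → ∑∈ (permutations n) (λ τ → f (insert Fin.zero j τ)))
  ∑∈-permutations-suc {n} f = trans
    (∑∈-cartesianProductWith (insert Fin.zero) (allFin (suc n)) (permutations n) f)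
    (∑∈-tabulate (λ j → j) (λ j → ∑∈ (permutations n) (λ τ → f (insert Fin.zero j τ))))

  -- Factorial moments of the number of hits.

  -- Position p of σ carries the label k + p, so that deleting position 0 leaves the values of f unchanged
  -- and only increments k; the values v with f v < k can no longer be hit.
  hits : ∀ {n} → (Fin n → ℕ) → ℕ → Permutation′ n → ℕ
  hits f k σ = sum λ p → 𝟙 (f (σ ⟨$⟩ʳ p) ≟ k + toℕ p)

  live : ∀ {n} → (Fin n → ℕ) → ℕ → ℕ
  live f k = sum λ v → 𝟙 (k ≤? f v)

  hits-insert : ∀ {n} (f : Fin (suc n) → ℕ) k j (τ : Permutation′ n) →
    hits f k (insert Fin.zero j τ) ≡ 𝟙 (f j ≟ k) + hits (removeAt f j) (suc k) τ
  hits-insert f k j τ = cong₂ _+_ (cong (λ i → 𝟙 (f j ≟ i)) (+-identityʳ k))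
    (sum-cong-≗ λ p → cong₂ (λ v i → 𝟙 (f v ≟ i)) (insert-punchIn Fin.zero j τ p) (+-suc k (toℕ p)))

  𝟙-≡-+-< : ∀ {k x} (d : Dec (x ≡ k)) (e : Dec (k < x)) (g : Dec (k ≤ x)) → 𝟙 d + 𝟙 e ≡ 𝟙 g
  𝟙-≡-+-< (yes refl) (yes k<k) _         = contradiction k<k (<-irrefl refl)
  𝟙-≡-+-< (yes refl) (no _)    (yes _)   = refl
  𝟙-≡-+-< (yes refl) (no _)    (no k≰k)  = contradiction ≤-refl k≰k
  𝟙-≡-+-< (no _)     (yes _)   (yes _)   = refl
  𝟙-≡-+-< (no _)     (yes k<x) (no k≰x)  = contradiction (<⇒≤ k<x) k≰x
  𝟙-≡-+-< (no x≢k)   (no k≮x)  (yes k≤x) = contradiction (≤-antisym (≮⇒≥ k≮x) k≤x) x≢k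
  𝟙-≡-+-< (no _)     (no _)    (no _)    = refl

  live-suc : ∀ {n} (f : Fin n → ℕ) k → live f k ≡ sum (λ v → 𝟙 (f v ≟ k)) + live f (suc k)
  live-suc f k = sym (trans (sym (∑-distrib-+ (λ v → 𝟙 (f v ≟ k)) _)) (sum-cong-≗ (λ v → 𝟙-≡-+-< (f v ≟ k) (k <? f v) (k ≤? f v))))

  ↓-𝟙 : ∀ {P : Set} (d : Dec P) x t → (𝟙 d + x) ↓ suc t ≡ x ↓ suc t + 𝟙 d * (suc t * x ↓ t)
  ↓-𝟙 (yes _) x t = trans (suc-↓ x t) (cong (x ↓ suc t +_) (sym (+-identityʳ _)))
  ↓-𝟙 (no _)  x t = sym (+-identityʳ _)

  -- Where the indicator is one, x is the predecessor of `𝟙 d + x`. In `∑-live-removeAt` that total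
  -- is the same for every removed value, so the factor becomes constant and leaves the sum.
  𝟙-pred : ∀ {P : Set} (d : Dec P) (g : ℕ → ℕ) x → 𝟙 d * g x ≡ 𝟙 d * g (pred (𝟙 d + x))
  𝟙-pred (yes _) g x = refl
  𝟙-pred (no _)  g x = refl

  -- Removing each of n + 1 values in turn from a set of b of them leaves b - 1 values b times, and b values otherwise.
  ∑-live-removeAt : ∀ {n} (f : Fin (suc n) → ℕ) k t → let b = live f k in
    sum (λ j → live (removeAt f j) k ↓ suc t) + t * b ↓ suc t ≡ n * b ↓ suc t
  -- With one more `b ↓ suc t` on both sides, the right is a sum of n + 1 equal terms. On the left,
  -- the factor b of `b ↓ suc t` is written as the sum of the indicators `u j`; Pascal's rule then
  -- makes the summand of each j equal to `b ↓ suc t`.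
  ∑-live-removeAt {n} f k t = +-cancelˡ-≡ (b ↓ suc t) _ _ (begin
    b ↓ suc t + (A + t * b ↓ suc t)                           ≡⟨ e₁ (b ↓ suc t) A t ⟩
    A + suc t * b ↓ suc t                                     ≡⟨ cong (λ x → A + suc t * x) (*-pred-↓ b t) ⟨
    A + suc t * (b * pred b ↓ t)                              ≡⟨ cong (A +_) (e₂ (suc t) b (pred b ↓ t)) ⟩
    A + b * (suc t * pred b ↓ t)                              ≡⟨ cong (A +_) (*-distribʳ-sum (suc t * pred b ↓ t) u) ⟩
    A + sum (λ j → u j * (suc t * pred b ↓ t))                ≡⟨ ∑-distrib-+ (λ j → c j ↓ suc t) (λ j → u j * (suc t * pred b ↓ t)) ⟨
    sum (λ j → c j ↓ suc t + u j * (suc t * pred b ↓ t))      ≡⟨ sum-cong-≗ step ⟩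
    sum {suc n} (λ _ → b ↓ suc t)                             ≡⟨ sum-const (suc n) (b ↓ suc t) ⟩
    suc n * b ↓ suc t                                         ∎)
    where
    open ≡-Reasoning
    b = live f k
    c = λ j → live (removeAt f j) k
    u = λ j → 𝟙 (k ≤? f j)
    A = sum (λ j → c j ↓ suc t)
    b≡ : ∀ j → b ≡ u j + c j
    b≡ j = sum-remove {i = j} u
    step : ∀ j → c j ↓ suc t + u j * (suc t * pred b ↓ t) ≡ b ↓ suc t
    step j rewrite b≡ j = trans (cong (c j ↓ suc t +_) (sym (𝟙-pred (k ≤? f j) (λ y → suc t * y ↓ t) (c j)))) (sym (↓-𝟙 (k ≤? f j) (c j) t))
    e₁ : ∀ B A t → B + (A + t * B) ≡ A + suc t * B
    e₁ = ℕ-Ring.solve-∀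
    e₂ : ∀ t b x → t * (b * x) ≡ b * (t * x)
    e₂ = ℕ-Ring.solve-∀

  -- There are `live f k ↓ t` ordered t-tuples of distinct live values, and at most (n - t)!
  -- permutations hit all values of a given one, since `f v` fixes the position of v. The proof is
  -- an induction on n over the value at position 0; Pascal's rule separates the tuples that use a
  -- hit there from those that do not.
  ∑-hits-↓ : ∀ n t (f : Fin n → ℕ) k → ∑∈ (permutations n) (λ σ → hits f k σ ↓ t) ≤ live f k ↓ t * [ n - t ]!
  ∑-hits-↓ n       zero    f k = ≤-reflexive (trans (∑∈-const (permutations n) 1)
    (trans (*-identityʳ _) (trans (length-permutations n) (sym (+-identityʳ _)))))
  ∑-hits-↓ zero    (suc t) f k = z≤n
  ∑-hits-↓ (suc n) (suc t) f k = begin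
    ∑∈ (permutations (suc n)) (λ σ → hits f k σ ↓ suc t)
      ≡⟨ ∑∈-permutations-suc (λ σ → hits f k σ ↓ suc t) ⟩
    sum (λ j → ∑∈ Sₙ (λ τ → hits f k (insert Fin.zero j τ) ↓ suc t))
      ≤⟨ sum-mono-≤ split ⟩
    sum (λ j → c j ↓ suc t * q + e j * (suc t * (b ↓ t * Q)))
      ≡⟨ ∑-distrib-+ (λ j → c j ↓ suc t * q) (λ j → e j * (suc t * (b ↓ t * Q))) ⟩
    sum (λ j → c j ↓ suc t * q) + sum (λ j → e j * (suc t * (b ↓ t * Q)))
      ≡⟨ cong₂ _+_ (*-distribʳ-sum q (λ j → c j ↓ suc t)) (*-distribʳ-sum (suc t * (b ↓ t * Q)) e) ⟨
    A * q + a * (suc t * (b ↓ t * Q))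
      ≤⟨ +-monoˡ-≤ _ A*q≤ ⟩
    b ↓ suc t * Q + a * (suc t * (b ↓ t * Q))
      ≡⟨ e₄ (b ↓ suc t) Q a (suc t) (b ↓ t) ⟩
    (b ↓ suc t + a * (suc t * b ↓ t)) * Q
      -- `a` counts the values that position 0 can hit and `b` those live after it; together they
      -- are the values live at `k`.
      ≤⟨ *-monoˡ-≤ Q (+-↓ a b t) ⟩
    (a + b) ↓ suc t * Q
      ≡⟨ cong (λ x → x ↓ suc t * Q) (live-suc f k) ⟨
    live f k ↓ suc t * Q ∎
    where
    open ≤-Reasoning
    Sₙ = permutations n
    Q = [ n - t ]!
    q = [ n - suc t ]!
    e = λ j → 𝟙 (f j ≟ k)
    a = sum e
    b = live f (suc k)
    c = λ j → live (removeAt f j) (suc k)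
    A = sum (λ j → c j ↓ suc t)
    c≤b : ∀ j → c j ≤ b
    c≤b j = ≤-trans (m≤n+m (c j) _) (≤-reflexive (sym (sum-remove {i = j} (λ v → 𝟙 (k <? f v)))))
    split : ∀ j → ∑∈ Sₙ (λ τ → hits f k (insert Fin.zero j τ) ↓ suc t) ≤ c j ↓ suc t * q + e j * (suc t * (b ↓ t * Q))
    split j = begin
      ∑∈ Sₙ (λ τ → hits f k (insert Fin.zero j τ) ↓ suc t)
        ≡⟨ ∑∈-cong Sₙ (λ τ → trans (cong (_↓ suc t) (hits-insert f k j τ)) (↓-𝟙 (f j ≟ k) (X τ) t)) ⟩
      ∑∈ Sₙ (λ τ → X τ ↓ suc t + e j * (suc t * X τ ↓ t))
        ≡⟨ ∑∈-distrib-+ Sₙ _ _ ⟩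
      ∑∈ Sₙ (λ τ → X τ ↓ suc t) + ∑∈ Sₙ (λ τ → e j * (suc t * X τ ↓ t))
        ≡⟨ cong (∑∈ Sₙ (λ τ → X τ ↓ suc t) +_) (trans (cong (e j *_) (*-distribˡ-∑∈ (suc t) Sₙ _)) (*-distribˡ-∑∈ (e j) Sₙ _)) ⟨
      ∑∈ Sₙ (λ τ → X τ ↓ suc t) + e j * (suc t * ∑∈ Sₙ (λ τ → X τ ↓ t))
        -- In the second term `c j` gives way to `b`. Nothing is lost: the weight `e j` is nonzero
        -- only when `f j` is `k`, and such a j is not live at `suc k`.
        ≤⟨ +-mono-≤ (∑-hits-↓ n (suc t) (removeAt f j) (suc k))
             (*-monoʳ-≤ (e j) (*-monoʳ-≤ (suc t) (≤-trans (∑-hits-↓ n t (removeAt f j) (suc k)) (*-monoˡ-≤ Q (↓-monoˡ-≤ t (c≤b j)))))) ⟩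
      c j ↓ suc t * q + e j * (suc t * (b ↓ t * Q)) ∎
      where X = hits (removeAt f j) (suc k)
    A*q≤ : A * q ≤ b ↓ suc t * Q
    -- Adding the same term on both sides avoids the factor n - t: `A` is (n - t) * `b ↓ suc t`, and
    -- (n - t) * `q` is at most `Q`.
    A*q≤ = +-cancelʳ-≤ (t * b ↓ suc t * q) _ _ (begin
      A * q + t * b ↓ suc t * q              ≡⟨ *-distribʳ-+ q A _ ⟨
      (A + t * b ↓ suc t) * q                ≡⟨ cong (_* q) (∑-live-removeAt f (suc k) t) ⟩
      n * b ↓ suc t * q                      ≡⟨ e₁ n (b ↓ suc t) q ⟩
      b ↓ suc t * (n * q)                    ≤⟨ *-monoʳ-≤ (b ↓ suc t) (n*[n-1+t]!≤ n t) ⟩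
      b ↓ suc t * (Q + t * q)                ≡⟨ e₃ (b ↓ suc t) Q t q ⟩
      b ↓ suc t * Q + t * b ↓ suc t * q      ∎)
      where
      e₁ : ∀ n b q → n * b * q ≡ b * (n * q)
      e₁ = ℕ-Ring.solve-∀
      e₃ : ∀ b Q t q → b * (Q + t * q) ≡ b * Q + t * b * q
      e₃ = ℕ-Ring.solve-∀
    e₄ : ∀ B Q a t b → B * Q + a * (t * (b * Q)) ≡ (B + a * (t * b)) * Q
    e₄ = ℕ-Ring.solve-∀

  -- The factorial moment is at most 1 on average over the n ! permutations: at offset 0 all n
  -- values are live.
  ∑-hits-↓-≤! : ∀ {n} t (f : Fin n → Fin n) → ∑∈ (permutations n) (λ σ → hits (toℕ ∘ f) 0 σ ↓ t) ≤ n !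
  ∑-hits-↓-≤! {n} t f = begin
    ∑∈ (permutations n) (λ σ → hits (toℕ ∘ f) 0 σ ↓ t)   ≤⟨ ∑-hits-↓ n t (toℕ ∘ f) 0 ⟩
    live (toℕ ∘ f) 0 ↓ t * [ n - t ]!                    ≡⟨ cong (λ x → x ↓ t * [ n - t ]!) (trans (sum-const n 1) (*-identityʳ n)) ⟩
    n ↓ t * [ n - t ]!                                   ≤⟨ ↓*[-]!≤! n t ⟩
    n !                                                  ∎
    where open ≤-Reasoning

  -- Substituting s = σ p turns σ (f s) ≡ s into f (σ p) ≡ p.
  ∑-fixed≡hits : ∀ {n} (f : Fin n → Fin n) (σ : Permutation′ n) →
    sum (λ s → 𝟙 (σ ⟨$⟩ʳ f s Fin.≟ s)) ≡ hits (toℕ ∘ f) 0 σ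
  ∑-fixed≡hits f σ = trans (sum-permute (λ s → 𝟙 (σ ⟨$⟩ʳ f s Fin.≟ s)) σ)
    (sum-cong-≗ λ p → 𝟙-⇔ (σ ⟨$⟩ʳ f (σ ⟨$⟩ʳ p) Fin.≟ σ ⟨$⟩ʳ p) (toℕ (f (σ ⟨$⟩ʳ p)) ≟ toℕ p)
      (mk⇔ (λ eq → cong toℕ (Injection.injective (↔⇒↣ σ) eq)) (λ eq → cong (σ ⟨$⟩ʳ_) (toℕ-injective eq))))

  successes≡∑-hits : ∀ {n} (S : Strategy n) → length (filter (success? S) (inputs n)) ≡
    ∑∈ (permutations n) (λ σ → hits (toℕ ∘ index S (hint S σ)) 0 σ)
  successes≡∑-hits {n} S = trans (length-filter-∑∈ (success? S) (inputs n))
    (trans (∑∈-cartesianProductWith _,_ (permutations n) (allFin n) (λ x → 𝟙 (success? S x)))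
      (∑∈-cong (permutations n) λ σ → trans (∑∈-tabulate (λ s → s) (λ s → 𝟙 (success? S (σ , s))))
        (∑-fixed≡hits (index S (hint S σ)) σ)))

  -- Here `suc t` is the t of the overview. Both sides are multiplied by (t + 1)! to stay in the
  -- natural numbers.
  successes≤ : ∀ {n} (S : Strategy n) t → n ≤ suc t ! → length (filter (success? S) (inputs n)) ≤ n ! * suc t
  successes≤ {n} S t n≤t! = *-cancelˡ-≤ F {{suc t !≢0}} (begin
    F * length (filter (success? S) (inputs n))           ≡⟨ cong (F *_) (successes≡∑-hits S) ⟩
    F * ∑∈ Sₙ (λ σ → X (h σ) σ)                           ≡⟨ *-distribˡ-∑∈ F Sₙ _ ⟩
    ∑∈ Sₙ (λ σ → F * X (h σ) σ)                           ≤⟨ ∑∈-mono-≤ Sₙ (λ σ → !*x≤!*t+↓ t (X (h σ) σ)) ⟩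
    -- The hint may depend on σ in any way. Summing over all possible hints removes this dependence
    -- at the cost of a factor n, which `n≤t!` absorbs.
    ∑∈ Sₙ (λ σ → F * t + X (h σ) σ ↓ suc t)               ≤⟨ ∑∈-mono-≤ Sₙ (λ σ → +-monoʳ-≤ (F * t) (sum-≥ (λ v → X v σ ↓ suc t) (h σ))) ⟩
    ∑∈ Sₙ (λ σ → F * t + sum (λ v → X v σ ↓ suc t))       ≡⟨ ∑∈-distrib-+ Sₙ _ _ ⟩
    ∑∈ Sₙ (λ _ → F * t) + ∑∈ Sₙ (λ σ → sum (λ v → X v σ ↓ suc t))
      ≡⟨ cong₂ _+_ (trans (∑∈-const Sₙ (F * t)) (cong (_* (F * t)) (length-permutations n))) (∑∈-sum-comm Sₙ (λ σ v → X v σ ↓ suc t)) ⟩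
    n ! * (F * t) + sum (λ v → ∑∈ Sₙ (λ σ → X v σ ↓ suc t)) ≤⟨ +-monoʳ-≤ (n ! * (F * t)) (sum-mono-≤ (λ v → ∑-hits-↓-≤! (suc t) (index S v))) ⟩
    n ! * (F * t) + sum {n} (λ _ → n !)                   ≡⟨ cong (n ! * (F * t) +_) (sum-const n (n !)) ⟩
    n ! * (F * t) + n * n !                               ≤⟨ +-monoʳ-≤ (n ! * (F * t)) (*-monoˡ-≤ (n !) n≤t!) ⟩
    n ! * (F * t) + F * n !                               ≡⟨ e (n !) F t ⟩
    F * (n ! * suc t)                                     ∎)
    where
    open ≤-Reasoning
    F = suc t !
    Sₙ = permutations n
    h = hint S
    X : Fin n → Permutation′ n → ℕ
    X v = hits (toℕ ∘ index S v) 0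
    e : ∀ m F t → m * (F * t) + F * m ≡ F * (m * suc t)
    e = ℕ-Ring.solve-∀

-- Size of the threshold t.

module Asymptotics where

  open import Data.Nat
  open import Data.Nat.DivMod using (_/_; m/n*n≤m; m≡m%n+[m/n]*n; m%n<n)
  open import Data.Nat.Logarithm using (⌊log₂_⌋; ⌊log₂⌋-mono-≤; ⌊log₂[2^n]⌋≡n)
  open import Data.Nat.Properties
  import Data.Nat.Tactic.RingSolver as ℕ-Ring
  open import Relation.Binary.PropositionalEquality using (_≡_; sym; cong; subst)
  open import Defs using (module ℕ-Logarithm)
  open ℕ-Logarithm using (2^⌊log₂n⌋≤n; n<2^1+⌊log₂n⌋)
  open ≤-Reasoning

  n<2^n : ∀ n → n < 2 ^ n
  n<2^n zero    = s≤s z≤n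
  n<2^n (suc n) = begin-strict
    suc n              ≤⟨ n<2^n n ⟩
    2 ^ n              <⟨ m<m+n (2 ^ n) (m^n>0 2 n) ⟩
    2 ^ n + 2 ^ n      ≡⟨ cong (2 ^ n +_) (+-identityʳ (2 ^ n)) ⟨
    2 ^ suc n          ∎

  2*n≤2^n : ∀ n → 2 * n ≤ 2 ^ n
  2*n≤2^n zero    = z≤n
  2*n≤2^n (suc n) = *-monoʳ-≤ 2 (n<2^n n)

  quadratic≤2^ : ∀ m → 2 * (m * m) + 26 * m ≤ 12 * 2 ^ m + 12
  quadratic≤2^ 0 = z≤n
  quadratic≤2^ 1 = m≤m+n 28 8
  quadratic≤2^ 2 = ≤-refl
  -- From m to m + 1 the left side grows by 4 m + 28 and the right by 12 * 2 ^ m, which is larger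
  -- only from m = 2 on; hence three base cases, the last an equality.
  quadratic≤2^ (suc m@(suc (suc k))) = begin
    2 * (suc m * suc m) + 26 * suc m             ≡⟨ e₁ m ⟩
    (2 * (m * m) + 26 * m) + (4 * m + 28)        ≤⟨ +-mono-≤ (quadratic≤2^ m) small ⟩
    (12 * 2 ^ m + 12) + 12 * 2 ^ m               ≡⟨ e₂ (2 ^ m) ⟩
    12 * 2 ^ suc m + 12                          ∎
    where
    e₁ : ∀ m → 2 * (suc m * suc m) + 26 * suc m ≡ (2 * (m * m) + 26 * m) + (4 * m + 28)
    e₁ = ℕ-Ring.solve-∀
    e₂ : ∀ p → (12 * p + 12) + 12 * p ≡ 12 * (2 * p) + 12
    e₂ = ℕ-Ring.solve-∀
    e₃ : ∀ k → 4 * suc (suc k) + 28 + 8 * k ≡ 12 * suc (suc (suc k))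
    e₃ = ℕ-Ring.solve-∀
    small : 4 * m + 28 ≤ 12 * 2 ^ m
    small = ≤-trans (m≤m+n (4 * m + 28) (8 * k)) (≤-trans (≤-reflexive (e₃ k)) (*-monoʳ-≤ 12 (n<2^n m)))

  -- The last r factors of (s + r)! all exceed s.
  ^≤+! : ∀ s r → s ^ r ≤ (s + r) !
  ^≤+! s zero    = subst (λ k → 1 ≤ k !) (sym (+-identityʳ s)) (1≤n! s)
  ^≤+! s (suc r) = begin
    s * s ^ r                  ≤⟨ *-mono-≤ (m≤n⇒m≤1+n (m≤m+n s r)) (^≤+! s r) ⟩
    suc (s + r) * (s + r) !    ≡⟨ cong _! (+-suc s r) ⟨
    (s + suc r) !              ∎

  2*⌊log₂n⌋≤n : ∀ n → 2 * ⌊log₂ n ⌋ ≤ n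
  2*⌊log₂n⌋≤n zero      = z≤n
  2*⌊log₂n⌋≤n n@(suc _) = ≤-trans (2*n≤2^n ⌊log₂ n ⌋) (2^⌊log₂n⌋≤n n)

  -- The exponent j of s = 2 ^ j. Subtracting 2 m divides s by about l ², which makes s negligible
  -- against L / l, while j stays close to l. The `suc` allows division by j.
  width : ℕ → ℕ
  width l = suc (l ∸ 2 * ⌊log₂ l ⌋)

  -- The width falls short of l + 1 by 2 m; relative to the width this is at most 12 / (m + 1),
  -- because l ≥ 2 ^ m outgrows m ².
  2*m*[1+m]≤12*width : ∀ l → let m = ⌊log₂ l ⌋ in 2 * m * suc m ≤ 12 * width l
  2*m*[1+m]≤12*width zero = z≤n
  2*m*[1+m]≤12*width l@(suc _) = +-cancelʳ-≤ (24 * m) _ _ (begin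
    2 * m * suc m + 24 * m       ≡⟨ e₁ m ⟩
    2 * (m * m) + 26 * m         ≤⟨ quadratic≤2^ m ⟩
    12 * 2 ^ m + 12              ≤⟨ +-monoˡ-≤ 12 (*-monoʳ-≤ 12 (2^⌊log₂n⌋≤n l)) ⟩
    12 * l + 12                  ≡⟨ cong (λ x → 12 * x + 12) (m∸n+n≡m (2*⌊log₂n⌋≤n l)) ⟨
    12 * (d + 2 * m) + 12        ≡⟨ e₂ d m ⟩
    12 * suc d + 24 * m          ∎)
    where
    m = ⌊log₂ l ⌋
    d = l ∸ 2 * m
    e₁ : ∀ m → 2 * m * suc m + 24 * m ≡ 2 * (m * m) + 26 * m
    e₁ = ℕ-Ring.solve-∀
    e₂ : ∀ d m → 12 * (d + 2 * m) + 12 ≡ 12 * suc d + 24 * m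
    e₂ = ℕ-Ring.solve-∀

  -- t - 1 for the t of the header: s + r with s = 2 ^ j and r = 1 + ⌊L / j⌋.
  threshold-1 : ℕ → ℕ
  threshold-1 n = 2 ^ j + ⌊log₂ n ⌋ / j
    where j = width ⌊log₂ ⌊log₂ n ⌋ ⌋

  n≤threshold! : ∀ n → n ≤ suc (threshold-1 n) !
  n≤threshold! n = begin
    n                              ≤⟨ <⇒≤ (n<2^1+⌊log₂n⌋ n) ⟩
    2 ^ suc L                      ≤⟨ ^-monoʳ-≤ 2 L<j*[1+r] ⟩
    2 ^ (j * suc r)                ≡⟨ ^-*-assoc 2 j (suc r) ⟨
    (2 ^ j) ^ suc r                ≤⟨ ^≤+! (2 ^ j) (suc r) ⟩
    (2 ^ j + suc r) !              ≡⟨ cong _! (+-suc (2 ^ j) r) ⟩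
    suc (threshold-1 n) !          ∎
    where
    L = ⌊log₂ n ⌋
    j = width ⌊log₂ L ⌋
    r = L / j
    -- The power is `suc r` because the remainder of L modulo j and the rounding in n < 2 ^ (L + 1)
    -- must be covered too.
    L<j*[1+r] : L < j * suc r
    L<j*[1+r] = begin-strict
      L               ≡⟨ m≡m%n+[m/n]*n L j ⟩
      L % j + r * j   <⟨ +-monoˡ-< (r * j) (m%n<n L j) ⟩
      j + r * j       ≡⟨ *-comm (suc r) j ⟩
      j * suc r       ∎

  -- With P = 2 ^ m, (l + 1) (m + 1) is at most 2 P ², and 2 ^ d * P ² = 2 ^ l ≤ L. So the summand s
  -- = 2 * 2 ^ d contributes at most 4 L and the summand 1 at most 2 L. For r, l + 1 = j + 2 m and r
  -- j ≤ L give L (m + 1) + 12 L.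
  threshold-≤ : ∀ n → 2 ≤ n → let L = ⌊log₂ n ⌋ ; l = ⌊log₂ L ⌋ ; m = ⌊log₂ l ⌋ in
    suc (threshold-1 n) * (suc l * suc m) ≤ L * (m + 19)
  threshold-≤ n 2≤n = begin
    suc (2 ^ j + r) * (suc l * suc m)
      ≡⟨ e₀ (2 ^ d) r (suc l) (suc m) ⟩
    2 * 2 ^ d * (suc l * suc m) + suc l * suc m + r * (suc l * suc m)
      ≤⟨ +-mono-≤ (+-mono-≤ (≤-trans (*-monoʳ-≤ (2 * 2 ^ d) [1+l]*[1+m]≤) (≤-trans (≤-reflexive (e₁ (2 ^ d) P)) (*-monoʳ-≤ 4 2^d*P*P≤L)))
                            (≤-trans [1+l]*[1+m]≤ (*-monoʳ-≤ 2 (≤-trans (m≤n*m (P * P) (2 ^ d)) 2^d*P*P≤L))))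
                  last-term ⟩
    4 * L + 2 * L + (L * suc m + L * 12)
      ≡⟨ e₂ L m ⟩
    L * (m + 19) ∎
    where
    L = ⌊log₂ n ⌋
    l = ⌊log₂ L ⌋
    m = ⌊log₂ l ⌋
    d = l ∸ 2 * m
    j = width l
    r = L / j
    P = 2 ^ m
    instance
      2^d≢0 : NonZero (2 ^ d)
      2^d≢0 = m^n≢0 2 d
      L≢0 : NonZero L
      L≢0 = >-nonZero (⌊log₂⌋-mono-≤ 2≤n)
    l≡ : d + 2 * m ≡ l
    l≡ = m∸n+n≡m (2*⌊log₂n⌋≤n l)
    [1+l]*[1+m]≤ : suc l * suc m ≤ 2 * (P * P)
    [1+l]*[1+m]≤ = ≤-trans (*-mono-≤ (n<2^1+⌊log₂n⌋ l) (n<2^n m)) (≤-reflexive (*-assoc 2 P P))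
    2^d*P*P≤L : 2 ^ d * (P * P) ≤ L
    2^d*P*P≤L = begin
      2 ^ d * (P * P)      ≡⟨ cong (2 ^ d *_) (^-distribˡ-+-* 2 m m) ⟨
      2 ^ d * 2 ^ (m + m)  ≡⟨ ^-distribˡ-+-* 2 d (m + m) ⟨
      2 ^ (d + (m + m))    ≡⟨ cong (λ x → 2 ^ (d + (m + x))) (+-identityʳ m) ⟨
      2 ^ (d + 2 * m)      ≡⟨ cong (2 ^_) l≡ ⟩
      2 ^ l                ≤⟨ 2^⌊log₂n⌋≤n L ⟩
      L                    ∎
    e₀ : ∀ D r a b → suc (2 * D + r) * (a * b) ≡ 2 * D * (a * b) + a * b + r * (a * b)
    e₀ = ℕ-Ring.solve-∀
    e₁ : ∀ D P → 2 * D * (2 * (P * P)) ≡ 4 * (D * (P * P))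
    e₁ = ℕ-Ring.solve-∀
    e₂ : ∀ L m → 4 * L + 2 * L + (L * suc m + L * 12) ≡ L * (m + 19)
    e₂ = ℕ-Ring.solve-∀
    e₃ : ∀ r d m → r * (suc (d + 2 * m) * suc m) ≡ r * suc d * suc m + r * (2 * m * suc m)
    e₃ = ℕ-Ring.solve-∀
    e₄ : ∀ r j → r * (12 * j) ≡ r * j * 12
    e₄ = ℕ-Ring.solve-∀
    last-term : r * (suc l * suc m) ≤ L * suc m + L * 12
    last-term = begin
      r * (suc l * suc m)                    ≡⟨ cong (λ x → r * (suc x * suc m)) l≡ ⟨
      r * (suc (d + 2 * m) * suc m)          ≡⟨ e₃ r d m ⟩
      r * j * suc m + r * (2 * m * suc m)    ≤⟨ +-monoʳ-≤ (r * j * suc m) (*-monoʳ-≤ r (2*m*[1+m]≤12*width l)) ⟩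
      r * j * suc m + r * (12 * j)           ≡⟨ cong (r * j * suc m +_) (e₄ r j) ⟩
      r * j * suc m + r * j * 12             ≤⟨ +-mono-≤ (*-monoˡ-≤ (suc m) (m/n*n≤m L j)) (*-monoˡ-≤ 12 (m/n*n≤m L j)) ⟩
      L * suc m + L * 12                     ∎

  ⌊log₂⌋-≥ : ∀ e {n} → 2 ^ e ≤ n → e ≤ ⌊log₂ n ⌋
  ⌊log₂⌋-≥ e {n} 2^e≤n = subst (_≤ ⌊log₂ n ⌋) (⌊log₂[2^n]⌋≡n e) (⌊log₂⌋-mono-≤ 2^e≤n)

open import Defs
open import Data.Integer as ℤ using (+_; +[1+_])
import Data.Integer.Properties as ℤ
open import Data.List using ([]; _∷_; map; length; filter)
open import Data.List.Relation.Unary.All using (All; []; _∷_)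
open import Data.Nat as ℕ using (ℕ; zero; suc; _!)
open import Data.Nat.Coprimality using (1-coprimeTo) renaming (sym to coprime-sym)
open import Data.Nat.Logarithm using (⌊log₂_⌋)
import Data.Nat.Properties as ℕ
import Data.Nat.Tactic.RingSolver as ℕ-Ring
open import Data.Product using (∃-syntax; _×_; _,_; proj₁)
open import Data.Rational as ℚ using (ℚ; mkℚ; 0ℚ; 1ℚ; ↥_; ↧ₙ_)
import Data.Rational.Properties as ℚ
open import Data.Rational.Solver using (module +-*-Solver)
import Data.Rational.Unnormalised as ℚᵘ
import Data.Rational.Unnormalised.Properties as ℚᵘ
open import Relation.Binary.PropositionalEquality using (_≡_; refl; sym; trans; cong; cong₂; subst; subst₂)
open Counting using (successes≤)
open Asymptotics
open ℕ-Logarithm using (2^⌊log₂n⌋≤n; n<2^1+⌊log₂n⌋; ^-distribʳ-*)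

-- Rational bounds for the logarithms and the deterministic case.

ι : ℕ → ℚ
ι n = + n ℚ./ 1

ι-mono-≤ : ∀ {m n} → m ℕ.≤ n → ι m ℚ.≤ ι n
ι-mono-≤ {m} {n} m≤n rewrite n/1≡ m | n/1≡ n = ℚ.*≤* (ℤ.*-monoʳ-≤-nonNeg (+ 1) (ℤ.+≤+ m≤n))

ι-* : ∀ m n → ι (m ℕ.* n) ≡ ι m ℚ.* ι n
ι-* m n rewrite n/1≡ m | n/1≡ n = cong (ℚ._/ 1) (ℤ.pos-* m n)

ι-+ : ∀ m n → ι (m ℕ.+ n) ≡ ι m ℚ.+ ι n
ι-+ m n rewrite n/1≡ m | n/1≡ n = cong (ℚ._/ 1) (sym (cong₂ ℤ._+_ (ℤ.*-identityʳ (+ m)) (ℤ.*-identityʳ (+ n))))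

ι-nonNegative : ∀ n → ℚ.NonNegative (ι n)
ι-nonNegative n = ℚ.normalize-nonNeg n 1

ι-positive : ∀ n .{{_ : ℕ.NonZero n}} → ℚ.Positive (ι n)
ι-positive n = ℚ.normalize-pos n 1

m/n*n≡m : ∀ m n .{{_ : ℕ.NonZero n}} → (+ m ℚ./ n) ℚ.* ι n ≡ ι m
m/n*n≡m m n@(suc n-1) = ℚ.toℚᵘ-injective (ℚᵘ.≃-trans (ℚ.toℚᵘ-homo-* (+ m ℚ./ n) (ι n))
  (ℚᵘ.≃-trans (ℚᵘ.*-cong (toℚᵘ-/ (+ m) n-1) (toℚᵘ-/ (+ n) 0))
  (ℚᵘ.≃-trans (ℚᵘ.*≡* (trans (ℤ.*-identityʳ _) (cong (λ x → + m ℤ.* + x) (sym (ℕ.*-identityʳ n)))))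
  (ℚᵘ.≃-sym (toℚᵘ-/ (+ m) 0)))))

≤ι⇒num≤ : ∀ {q} n → 0ℚ ℚ.< q → q ℚ.≤ ι n → ℤ.∣ ↥ q ∣ ℕ.≤ n ℕ.* ↧ₙ q
≤ι⇒num≤ {mkℚ +[1+ a ] b-1 _} n _ le rewrite n/1≡ n with ℚ.*≤* le′ ← le =
  subst (ℕ._≤ n ℕ.* suc b-1) (ℕ.*-identityʳ (suc a)) (ℤ.drop‿+≤+ (subst (+ (suc a ℕ.* 1) ℤ.≤_) (sym (ℤ.pos-* n (suc b-1))) le′))
≤ι⇒num≤ {mkℚ (+ zero) _ _} n (ℚ.*<* (ℤ.+<+ ()))
≤ι⇒num≤ {mkℚ ℤ.-[1+ _ ] _ _} n (ℚ.*<* ())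

-- Unlike in `log≈-lower` there is no error term: `p * K + B` is an integer, so a lower bound by it
-- survives the rounding down in `A`.
ι≤log≈ : ∀ q p k → 2 ℕ.^ p ℕ.* ↧ₙ q ℕ.≤ ℤ.∣ ↥ q ∣ → ι p ℚ.≤ log≈ k q
ι≤log≈ q p k hyp = subst₂ ℚ._≤_ (cong (ℚ._/ 1) (ℤ.+-identityʳ (+ p))) (ℚ.+-identityʳ (log≈ k q))
  (fraction-≤ p 0 A B 0 k 0ℚ 0 0 ℚᵘ.≃-refl (subst₂ ℕ._≤_ (e₁ p K B) (e₂ A K) main))
  where
  open ℕ.≤-Reasoning
  K = suc k
  A = ⌊log₂ ℤ.∣ ↥ q ∣ ℕ.^ K ⌋
  B = ⌊log₂ ↧ₙ q ℕ.^ K ⌋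
  main : p ℕ.* K ℕ.+ B ℕ.≤ A
  main = ⌊log₂⌋-≥ (p ℕ.* K ℕ.+ B) (begin
    2 ℕ.^ (p ℕ.* K ℕ.+ B)             ≡⟨ ℕ.^-distribˡ-+-* 2 (p ℕ.* K) B ⟩
    2 ℕ.^ (p ℕ.* K) ℕ.* 2 ℕ.^ B       ≤⟨ ℕ.*-monoʳ-≤ (2 ℕ.^ (p ℕ.* K)) (2^⌊log₂n⌋≤n (↧ₙ q ℕ.^ K) {{ℕ.m^n≢0 (↧ₙ q) K}}) ⟩
    2 ℕ.^ (p ℕ.* K) ℕ.* ↧ₙ q ℕ.^ K    ≡⟨ cong (ℕ._* ↧ₙ q ℕ.^ K) (ℕ.^-*-assoc 2 p K) ⟨
    (2 ℕ.^ p) ℕ.^ K ℕ.* ↧ₙ q ℕ.^ K    ≡⟨ ^-distribʳ-* (2 ℕ.^ p) (↧ₙ q) K ⟨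
    (2 ℕ.^ p ℕ.* ↧ₙ q) ℕ.^ K          ≤⟨ ℕ.^-monoˡ-≤ K hyp ⟩
    ℤ.∣ ↥ q ∣ ℕ.^ K                   ∎)
  e₁ : ∀ p K B → p ℕ.* K ℕ.+ B ≡ p ℕ.* (K ℕ.* 1) ℕ.+ B ℕ.* (1 ℕ.* 1)
  e₁ = ℕ-Ring.solve-∀
  e₂ : ∀ A K → A ≡ A ℕ.* (1 ℕ.* 1) ℕ.+ 0 ℕ.* (K ℕ.* 1) ℕ.+ 0 ℕ.* (1 ℕ.* K)
  e₂ = ℕ-Ring.solve-∀

-- Again exact: if A exceeded pK + B, then the numerator's K-th power would be at least 2 ^ (pK + B
-- + 1), although B + 1 already exceeds the logarithm of the denominator's K-th power.
log≈≤ι : ∀ {q} p k → 0ℚ ℚ.< q → ℤ.∣ ↥ q ∣ ℕ.≤ 2 ℕ.^ p ℕ.* ↧ₙ q → log≈ k q ℚ.≤ ι p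
log≈≤ι {q} p k 0<q hyp = subst (log≈ k q ℚ.≤_) (trans (ℚ.+-identityʳ _) (cong (ℚ._/ 1) (ℤ.+-identityʳ (+ p))))
  (fraction-≤ A B p 0 k 0 0ℚ 0 0 ℚᵘ.≃-refl (subst₂ ℕ._≤_ (e₁ A K) (e₂ p K B) main))
  where
  open ℕ.≤-Reasoning
  K = suc k
  A = ⌊log₂ ℤ.∣ ↥ q ∣ ℕ.^ K ⌋
  B = ⌊log₂ ↧ₙ q ℕ.^ K ⌋
  instance
    num^K≢0 : ℕ.NonZero (ℤ.∣ ↥ q ∣ ℕ.^ K)
    num^K≢0 = ℕ.m^n≢0 ℤ.∣ ↥ q ∣ K {{num-nonZero 0<q}}
    2^pK≢0 : ℕ.NonZero (2 ℕ.^ (p ℕ.* K))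
    2^pK≢0 = ℕ.m^n≢0 2 (p ℕ.* K)
  main : A ℕ.≤ p ℕ.* K ℕ.+ B
  main = ℕ.≮⇒≥ λ pK+B<A → ℕ.<-irrefl refl (begin-strict
    ℤ.∣ ↥ q ∣ ℕ.^ K                       ≤⟨ ℕ.^-monoˡ-≤ K hyp ⟩
    (2 ℕ.^ p ℕ.* ↧ₙ q) ℕ.^ K              ≡⟨ ^-distribʳ-* (2 ℕ.^ p) (↧ₙ q) K ⟩
    (2 ℕ.^ p) ℕ.^ K ℕ.* ↧ₙ q ℕ.^ K        ≡⟨ cong (ℕ._* ↧ₙ q ℕ.^ K) (ℕ.^-*-assoc 2 p K) ⟩
    2 ℕ.^ (p ℕ.* K) ℕ.* ↧ₙ q ℕ.^ K        <⟨ ℕ.*-monoʳ-< (2 ℕ.^ (p ℕ.* K)) (n<2^1+⌊log₂n⌋ (↧ₙ q ℕ.^ K)) ⟩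
    2 ℕ.^ (p ℕ.* K) ℕ.* 2 ℕ.^ suc B       ≡⟨ ℕ.^-distribˡ-+-* 2 (p ℕ.* K) (suc B) ⟨
    2 ℕ.^ (p ℕ.* K ℕ.+ suc B)             ≡⟨ cong (2 ℕ.^_) (ℕ.+-suc (p ℕ.* K) B) ⟩
    2 ℕ.^ suc (p ℕ.* K ℕ.+ B)             ≤⟨ ℕ.^-monoʳ-≤ 2 pK+B<A ⟩
    2 ℕ.^ A                               ≤⟨ 2^⌊log₂n⌋≤n (ℤ.∣ ↥ q ∣ ℕ.^ K) ⟩
    ℤ.∣ ↥ q ∣ ℕ.^ K                       ∎)
  e₁ : ∀ A K → A ≡ A ℕ.* (1 ℕ.* 1) ℕ.+ 0 ℕ.* (K ℕ.* 1)
  e₁ = ℕ-Ring.solve-∀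
  e₂ : ∀ p K B → p ℕ.* K ℕ.+ B ≡ p ℕ.* (K ℕ.* 1) ℕ.+ B ℕ.* (1 ℕ.* 1) ℕ.+ 0 ℕ.* (K ℕ.* 1)
  e₂ = ℕ-Ring.solve-∀

⌊log₂⌋≤log≈ : ∀ n k .{{_ : ℕ.NonZero n}} → ι ⌊log₂ n ⌋ ℚ.≤ log≈ k (ι n)
⌊log₂⌋≤log≈ n k rewrite n/1≡ n = ι≤log≈ (mkℚ (+ n) 0 (coprime-sym (1-coprimeTo n))) ⌊log₂ n ⌋ k
  (ℕ.≤-trans (ℕ.≤-reflexive (ℕ.*-identityʳ _)) (2^⌊log₂n⌋≤n n))

-- Since n + 1 ≤ 2 ^ (⌊log n⌋ + 1), the bound on q may be n + 1. This makes the lemma iterable: log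
-- n ≤ L + 1 yields log log n ≤ l + 1 and not l + 2.
log≈≤1+⌊log₂⌋ : ∀ n {q} k → 0ℚ ℚ.< q → q ℚ.≤ ι (suc n) → log≈ k q ℚ.≤ ι (suc ⌊log₂ n ⌋)
log≈≤1+⌊log₂⌋ n {q} k 0<q q≤ = log≈≤ι (suc ⌊log₂ n ⌋) k 0<q
  (ℕ.≤-trans (≤ι⇒num≤ (suc n) 0<q q≤) (ℕ.*-monoˡ-≤ (↧ₙ q) (n<2^1+⌊log₂n⌋ n)))

x*z≤y⇒x≤y*inv : ∀ {x y z} → 0ℚ ℚ.< z → x ℚ.* z ℚ.≤ y → x ℚ.≤ y ℚ.* inv z
x*z≤y⇒x≤y*inv {x} {y} {z} 0<z le = begin
  x                      ≡⟨ ℚ.*-identityʳ x ⟨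
  x ℚ.* 1ℚ               ≡⟨ cong (x ℚ.*_) (trans (ℚ.*-comm z (inv z)) (inv-inverse 0<z)) ⟨
  x ℚ.* (z ℚ.* inv z)    ≡⟨ ℚ.*-assoc x z (inv z) ⟨
  x ℚ.* z ℚ.* inv z      ≤⟨ ℚ.*-monoʳ-≤-nonNeg (inv z) {{ℚ.nonNegative (ℚ.<⇒≤ (inv-positive 0<z))}} le ⟩
  y ℚ.* inv z            ∎
  where open ℚ.≤-Reasoning

log₂³ : ℕ → ℕ
log₂³ n = ⌊log₂ ⌊log₂ ⌊log₂ n ⌋ ⌋ ⌋

rate : ℕ → ℚ
rate n = + 18 ℚ./ suc (log₂³ n)

0≤rate : ∀ n → 0ℚ ℚ.≤ rate n
0≤rate n = ℚ.nonNegative⁻¹ (rate n) {{ℚ.normalize-nonNeg 18 (suc (log₂³ n))}}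

threshold-≤ℚ : ∀ n → 2 ℕ.≤ n → let L = ⌊log₂ n ⌋ ; l = ⌊log₂ L ⌋ in
  ι (suc (threshold-1 n)) ℚ.* ι (suc l) ℚ.≤ (1ℚ ℚ.+ rate n) ℚ.* ι L
threshold-≤ℚ n 2≤n = ℚ.*-cancelʳ-≤-pos (ι M) {{ι-positive M}} (begin
  ι T ℚ.* ι (suc l) ℚ.* ι M           ≡⟨ cong (ℚ._* ι M) (ι-* T (suc l)) ⟨
  ι (T ℕ.* suc l) ℚ.* ι M             ≡⟨ ι-* (T ℕ.* suc l) M ⟨
  ι (T ℕ.* suc l ℕ.* M)               ≡⟨ cong ι (ℕ.*-assoc T (suc l) M) ⟩
  ι (T ℕ.* (suc l ℕ.* M))             ≤⟨ ι-mono-≤ (threshold-≤ n 2≤n) ⟩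
  -- m + 19 is M + 18, and 18 is `rate n` times M.
  ι (L ℕ.* (m ℕ.+ 19))                ≡⟨ cong (λ x → ι (L ℕ.* x)) (ℕ.+-suc m 18) ⟩
  ι (L ℕ.* (M ℕ.+ 18))                ≡⟨ trans (ι-* L (M ℕ.+ 18)) (cong (ι L ℚ.*_) (ι-+ M 18)) ⟩
  ι L ℚ.* (ι M ℚ.+ ι 18)              ≡⟨ cong (λ x → ι L ℚ.* (ι M ℚ.+ x)) (m/n*n≡m 18 M) ⟨
  ι L ℚ.* (ι M ℚ.+ rate n ℚ.* ι M)    ≡⟨ solve 3 (λ a b r → a :* (b :+ r :* b) := (con 1ℚ :+ r) :* a :* b) refl (ι L) (ι M) (rate n) ⟩
  (1ℚ ℚ.+ rate n) ℚ.* ι L ℚ.* ι M     ∎)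
  where
  open ℚ.≤-Reasoning
  open +-*-Solver
  L = ⌊log₂ n ⌋
  l = ⌊log₂ L ⌋
  m = log₂³ n
  M = suc m
  T = suc (threshold-1 n)

≤-from-ℚ : ∀ {x y} N → (∀ {k} → N ℕ.≤ k → seq x k ℚ.≤ seq y k) → x ≤ y
≤-from-ℚ {x} {y} N x≤y = *≤* λ {δ} 0<δ → N , λ {k} N≤k →
  ℚ.≤-trans (x≤y N≤k) (subst (ℚ._≤ seq y k ℚ.+ δ) (ℚ.+-identityʳ (seq y k)) (ℚ.+-monoʳ-≤ (seq y k) (ℚ.<⇒≤ 0<δ)))

threshold/n : (n : ℕ) .{{_ : ℕ.NonZero n}} → ℚ
threshold/n n = + suc (threshold-1 n) ℚ./ n

threshold/n≤ : ∀ n .{{_ : ℕ.NonZero n}} (n≥3 : 3 ℕ.≤ n) →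
  fromℚ (threshold/n n) ≤ ((1ℝ + fromℚ (rate n)) * log n n≥3) ÷ (fromℕ n * log-log n n≥3) [ n*log-log-positive n≥3 ]
-- From index 7 on, `log≈q≥1/8` keeps the approximations of log log n positive; the inequality then
-- holds between the approximations themselves.
threshold/n≤ n n≥3 = ≤-from-ℚ 7 λ {k} 7≤k → bound k 7≤k
  where
  open ℚ.≤-Reasoning
  open +-*-Solver
  L = ⌊log₂ n ⌋
  l = ⌊log₂ L ⌋
  T = suc (threshold-1 n)
  A = 1ℚ ℚ.+ rate n
  A≥0 : ℚ.NonNegative A
  A≥0 = ℚ.nonNegative (ℚ.+-mono-≤ (ℚ.nonNegative⁻¹ 1ℚ) (0≤rate n))
  0<ιn : 0ℚ ℚ.< ι n
  0<ιn = ℚ.positive⁻¹ (ι n) {{ι-positive n}}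
  bound : ∀ k → 7 ℕ.≤ k → threshold/n n ℚ.≤ (A ℚ.* log≈ k (ι n)) ℚ.* inv (ι n ℚ.* log≈ k (log≈ k (ι n)))
  bound k 7≤k = x*z≤y⇒x≤y*inv (*-positive 0<ιn 0<ll) (begin
    threshold/n n ℚ.* (ι n ℚ.* ll)    ≡⟨ ℚ.*-assoc (threshold/n n) (ι n) ll ⟨
    threshold/n n ℚ.* ι n ℚ.* ll      ≡⟨ cong (ℚ._* ll) (m/n*n≡m T n) ⟩
    ι T ℚ.* ll                        ≤⟨ ℚ.*-monoˡ-≤-nonNeg (ι T) {{ι-nonNegative T}} ll≤ ⟩
    ι T ℚ.* ι (suc l)                 ≤⟨ threshold-≤ℚ n (ℕ.≤-trans (ℕ.n≤1+n 2) n≥3) ⟩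
    A ℚ.* ι L                         ≤⟨ ℚ.*-monoˡ-≤-nonNeg A {{A≥0}} (⌊log₂⌋≤log≈ n k) ⟩
    A ℚ.* lg                          ∎)
    where
    lg = log≈ k (ι n)
    ll = log≈ k lg
    5/4≤lg : + 5 ℚ./ 4 ℚ.≤ lg
    5/4≤lg = log≈n≥5/4 {k = k} n≥3 (ℕ.≤-trans (ℕ.m≤m+n 3 4) 7≤k)
    0<lg : 0ℚ ℚ.< lg
    0<lg = ℚ.<-≤-trans (ℚ.positive⁻¹ (+ 5 ℚ./ 4)) 5/4≤lg
    0<ll : 0ℚ ℚ.< ll
    0<ll = ℚ.<-≤-trans (ℚ.positive⁻¹ (+ 1 ℚ./ 8)) (log≈q≥1/8 {k = k} 5/4≤lg 7≤k)
    lg≤ : lg ℚ.≤ ι (suc L)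
    lg≤ = log≈≤1+⌊log₂⌋ n k 0<ιn (ι-mono-≤ (ℕ.n≤1+n n))
    ll≤ : ll ℚ.≤ ι (suc l)
    ll≤ = log≈≤1+⌊log₂⌋ L k 0<lg lg≤

Pr≤threshold/n : ∀ {n} .{{_ : ℕ.NonZero n}} (S : Strategy n) → Pr[ S ] ℚ.≤ threshold/n n
Pr≤threshold/n {n} S = ℚ.*-cancelʳ-≤-pos (ι N) {{ι-positive N}} (begin
  Pr[ S ] ℚ.* ι N                         ≡⟨ m/n*n≡m (length (filter (success? S) (inputs n))) N ⟩
  ι (length (filter (success? S) (inputs n))) ≤⟨ ι-mono-≤ (successes≤ S (threshold-1 n) (n≤threshold! n)) ⟩
  ι (n ! ℕ.* T)                           ≡⟨ trans (ι-* (n !) T) (ℚ.*-comm (ι (n !)) (ι T)) ⟩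
  ι T ℚ.* ι (n !)                         ≡⟨ cong (ℚ._* ι (n !)) (m/n*n≡m T n) ⟨
  threshold/n n ℚ.* ι n ℚ.* ι (n !)       ≡⟨ solve 3 (λ t a b → t :* a :* b := t :* (b :* a)) refl (threshold/n n) (ι n) (ι (n !)) ⟩
  threshold/n n ℚ.* (ι (n !) ℚ.* ι n)     ≡⟨ cong (threshold/n n ℚ.*_) (trans (cong ι (length-inputs n)) (ι-* (n !) n)) ⟨
  threshold/n n ℚ.* ι N                   ∎)
  where
  open ℚ.≤-Reasoning
  open +-*-Solver
  T = suc (threshold-1 n)
  N = length (inputs n)
  instance
    N≢0 : ℕ.NonZero N
    N≢0 = inputs-nonEmpty n

-- Order on the reals and randomized strategies.

≤-reflᴿ : ∀ {x} → x ≤ x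
≤-reflᴿ = ≤-from-ℚ 0 λ _ → ℚ.≤-refl

≤-transᴿ : ∀ {x y z} → x ≤ y → y ≤ z → x ≤ z
≤-transᴿ {x} {y} {z} (*≤* x≤y) (*≤* y≤z) = *≤* λ {δ} 0<δ →
  let N₁ , p = x≤y (half-positive 0<δ)
      N₂ , q = y≤z (half-positive 0<δ)
  in N₁ ℕ.⊔ N₂ , λ {k} N≤k → begin
    seq x k                                     ≤⟨ p (ℕ.m⊔n≤o⇒m≤o N₁ N₂ N≤k) ⟩
    seq y k ℚ.+ ℚ.½ ℚ.* δ                       ≤⟨ ℚ.+-monoˡ-≤ (ℚ.½ ℚ.* δ) (q (ℕ.m⊔n≤o⇒n≤o N₁ N₂ N≤k)) ⟩
    (seq z k ℚ.+ ℚ.½ ℚ.* δ) ℚ.+ ℚ.½ ℚ.* δ       ≡⟨ trans (ℚ.+-assoc (seq z k) _ _) (cong (seq z k ℚ.+_) (half+half δ)) ⟩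
    seq z k ℚ.+ δ                               ∎
  where open ℚ.≤-Reasoning

+-mono-≤ᴿ : ∀ {x y u v} → x ≤ y → u ≤ v → x + u ≤ y + v
+-mono-≤ᴿ {x} {y} {u} {v} (*≤* x≤y) (*≤* u≤v) = *≤* λ {δ} 0<δ →
  let N₁ , p = x≤y (half-positive 0<δ)
      N₂ , q = u≤v (half-positive 0<δ)
  in N₁ ℕ.⊔ N₂ , λ {k} N≤k → begin
    seq x k ℚ.+ seq u k
      ≤⟨ ℚ.+-mono-≤ (p (ℕ.m⊔n≤o⇒m≤o N₁ N₂ N≤k)) (q (ℕ.m⊔n≤o⇒n≤o N₁ N₂ N≤k)) ⟩
    (seq y k ℚ.+ ℚ.½ ℚ.* δ) ℚ.+ (seq v k ℚ.+ ℚ.½ ℚ.* δ)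
      ≡⟨ solve 3 (λ y v h → (y :+ h) :+ (v :+ h) := (y :+ v) :+ (h :+ h)) refl (seq y k) (seq v k) (ℚ.½ ℚ.* δ) ⟩
    (seq y k ℚ.+ seq v k) ℚ.+ (ℚ.½ ℚ.* δ ℚ.+ ℚ.½ ℚ.* δ)
      ≡⟨ cong (seq y k ℚ.+ seq v k ℚ.+_) (half+half δ) ⟩
    (seq y k ℚ.+ seq v k) ℚ.+ δ ∎
  where
  open ℚ.≤-Reasoning
  open +-*-Solver

*-monoʳ-≤-fromℚ : ∀ {x y c} → 0ℚ ℚ.≤ c → x ≤ y → x * fromℚ c ≤ y * fromℚ c
*-monoʳ-≤-fromℚ {x} {y} {c} 0≤c (*≤* x≤y) = *≤* λ {δ} 0<δ →
  -- Tolerance δ / (c + 1) rather than δ / c, as c may be 0.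
  let N , p = x≤y (*-positive 0<δ (inv-positive 0<c+1))
  in N , λ {k} N≤k → begin
    seq x k ℚ.* c                                   ≤⟨ ℚ.*-monoʳ-≤-nonNeg c {{ℚ.nonNegative 0≤c}} (p N≤k) ⟩
    (seq y k ℚ.+ δ ℚ.* i) ℚ.* c                     ≡⟨ ℚ.*-distribʳ-+ c (seq y k) (δ ℚ.* i) ⟩
    seq y k ℚ.* c ℚ.+ δ ℚ.* i ℚ.* c                 ≤⟨ ℚ.+-monoʳ-≤ (seq y k ℚ.* c) (ℚ.*-monoˡ-≤-nonNeg (δ ℚ.* i) {{ℚ.nonNegative (ℚ.<⇒≤ (*-positive 0<δ (inv-positive 0<c+1)))}} c≤c+1) ⟩
    seq y k ℚ.* c ℚ.+ δ ℚ.* i ℚ.* (c ℚ.+ 1ℚ)        ≡⟨ cong (seq y k ℚ.* c ℚ.+_) (trans (ℚ.*-assoc δ i _) (trans (cong (δ ℚ.*_) (inv-inverse 0<c+1)) (ℚ.*-identityʳ δ))) ⟩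
    seq y k ℚ.* c ℚ.+ δ                             ∎
  where
  open ℚ.≤-Reasoning
  i = inv (c ℚ.+ 1ℚ)
  0<c+1 : 0ℚ ℚ.< c ℚ.+ 1ℚ
  0<c+1 = ℚ.+-mono-≤-< 0≤c (ℚ.positive⁻¹ 1ℚ)
  c≤c+1 : c ℚ.≤ c ℚ.+ 1ℚ
  c≤c+1 = subst (ℚ._≤ c ℚ.+ 1ℚ) (ℚ.+-identityʳ c) (ℚ.+-monoʳ-≤ c (ℚ.nonNegative⁻¹ 1ℚ))

-- The approximations of w ≥ 0 may be slightly negative, so this fails termwise. Instead w q = w (q
-- - p) + w p, and w (q - p) ≥ 0 because the rational factor is nonnegative.
*-monoˡ-≤-fromℚ : ∀ {w p q} → 0ℝ ≤ w → p ℚ.≤ q → w * fromℚ p ≤ w * fromℚ q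
*-monoˡ-≤-fromℚ {w} {p} {q} 0≤w p≤q = ≤-transᴿ {w * fromℚ p} {0ℝ * fromℚ (q ℚ.- p) + w * fromℚ p}
  (≤-from-ℚ 0 λ {k} _ → ℚ.≤-reflexive (solve 3 (λ w p q → w :* p := con 0ℚ :* (q :+ :- p) :+ w :* p) refl (seq w k) p q))
  (≤-transᴿ {y = w * fromℚ (q ℚ.- p) + w * fromℚ p}
    (+-mono-≤ᴿ {0ℝ * fromℚ (q ℚ.- p)} {w * fromℚ (q ℚ.- p)} {w * fromℚ p} (*-monoʳ-≤-fromℚ {0ℝ} {w} 0≤q-p 0≤w) (≤-reflᴿ {w * fromℚ p}))
    (≤-from-ℚ 0 λ {k} _ → ℚ.≤-reflexive (solve 3 (λ w p q → w :* (q :+ :- p) :+ w :* p := w :* q) refl (seq w k) p q)))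
  where
  open +-*-Solver
  0≤q-p : 0ℚ ℚ.≤ q ℚ.- p
  0≤q-p = subst (ℚ._≤ q ℚ.- p) (ℚ.+-inverseʳ p) (ℚ.+-monoˡ-≤ (ℚ.- p) p≤q)

weighted-≤ : ∀ {A : Set} (p : A → ℚ) {c} → (∀ a → p a ℚ.≤ c) → ∀ ws → All (λ (w , _) → 0ℝ ≤ w) ws →
  ∑ (map (λ (w , a) → w * fromℚ (p a)) ws) ≤ ∑ (map proj₁ ws) * fromℚ c
weighted-≤ p {c} p≤c [] [] = ≤-from-ℚ 0 λ _ → ℚ.≤-reflexive (sym (ℚ.*-zeroˡ c))
weighted-≤ p {c} p≤c ((w , a) ∷ ws) (0≤w ∷ 0≤ws) = ≤-transᴿ {y = w * fromℚ c + W * fromℚ c}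
  (+-mono-≤ᴿ {w * fromℚ (p a)} {w * fromℚ c} {∑ (map (λ (w , a) → w * fromℚ (p a)) ws)} (*-monoˡ-≤-fromℚ {w} 0≤w (p≤c a)) (weighted-≤ p p≤c ws 0≤ws))
  (≤-from-ℚ 0 λ {k} _ → ℚ.≤-reflexive (sym (ℚ.*-distribʳ-+ c (seq w k) (seq W k))))
  where W = ∑ (map proj₁ ws)

-- A mixture is an average of deterministic strategies, which all obey the same bound.
Prᴿ≤threshold/n : ∀ {n} .{{_ : ℕ.NonZero n}} (D : RandomizedStrategy n) → Prᴿ[ D ] ≤ fromℚ (threshold/n n)
Prᴿ≤threshold/n {n} D = ≤-transᴿ {y = W * fromℚ c} (weighted-≤ Pr[_] Pr≤threshold/n (support D) (nonNegative D))
  (≤-transᴿ {y = 1ℝ * fromℚ c} (*-monoʳ-≤-fromℚ {W} {1ℝ} 0≤c (proj₁ (total D)))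
    (≤-from-ℚ 0 λ _ → ℚ.≤-reflexive (ℚ.*-identityˡ c)))
  where
  W = ∑ (map proj₁ (support D))
  c = threshold/n n
  0≤c : 0ℚ ℚ.≤ c
  0≤c = ℚ.nonNegative⁻¹ c {{ℚ.normalize-nonNeg (suc (threshold-1 n)) n}}

-- Convergence of the error term.

fromℚ-mono-≤ : ∀ {p q} → p ℚ.≤ q → fromℚ p ≤ fromℚ q
fromℚ-mono-≤ p≤q = ≤-from-ℚ 0 λ _ → p≤q

log₂³-≥ : ∀ e {n} → 2 ℕ.^ (2 ℕ.^ (2 ℕ.^ e)) ℕ.≤ n → e ℕ.≤ log₂³ n
log₂³-≥ e le = ⌊log₂⌋-≥ e (⌊log₂⌋-≥ (2 ℕ.^ e) (⌊log₂⌋-≥ (2 ℕ.^ (2 ℕ.^ e)) le))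

rate-≤ : ∀ {δ} n → 0ℚ ℚ.< δ → 18 ℕ.* ↧ₙ δ ℕ.≤ log₂³ n → rate n ℚ.≤ δ
rate-≤ {mkℚ (+ zero) _ _} n (ℚ.*<* (ℤ.+<+ ()))
rate-≤ {mkℚ ℤ.-[1+ _ ] _ _} n (ℚ.*<* ())
rate-≤ {δ@(mkℚ +[1+ a ] b-1 _)} n _ le = ℚ.toℚᵘ-cancel-≤ (ℚᵘ.≤-respˡ-≃ (ℚᵘ.≃-sym (toℚᵘ-/ (+ 18) (log₂³ n)))
  (ℚᵘ.*≤* (subst₂ ℤ._≤_ (ℤ.pos-* 18 (suc b-1)) (ℤ.pos-* (suc a) (suc (log₂³ n)))
    (ℤ.+≤+ (ℕ.≤-trans le (ℕ.≤-trans (ℕ.n≤1+n _) (ℕ.m≤n*m (suc (log₂³ n)) (suc a))))))))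

rate⟶0 : (λ n → fromℚ (rate n)) ⟶0
-- With b the denominator of δ, this index makes m at least 18 b, so that 18 / (m + 1) ≤ 1 / b ≤ δ.
rate⟶0 {δ} 0<δ = 2 ℕ.^ (2 ℕ.^ (2 ℕ.^ (18 ℕ.* ↧ₙ δ))) , λ {n} N≤n →
  fromℚ-mono-≤ (ℚ.≤-trans (ℚ.neg-antimono-≤ (ℚ.<⇒≤ 0<δ)) (0≤rate n)) ,
  fromℚ-mono-≤ (rate-≤ n 0<δ (log₂³-≥ (18 ℕ.* ↧ₙ δ) N≤n))

theorem5 : ∃[ ε ] ε ⟶0 ×
    (∀ (n : ℕ) .{{_ : ℕ.NonZero n}} (n≥3 : 3 ℕ.≤ n) →
    (∀ (S : Strategy n) →
    fromℚ Pr[ S ] ≤ ((1ℝ + ε n) * log n n≥3) ÷ (fromℕ n * log-log n n≥3) [ n*log-log-positive n≥3 ]) ×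
    (∀ (D : RandomizedStrategy n) →
    Prᴿ[ D ] ≤ ((1ℝ + ε n) * log n n≥3) ÷ (fromℕ n * log-log n n≥3) [ n*log-log-positive n≥3 ]))
theorem5 = (λ n → fromℚ (rate n)) , rate⟶0 , λ n n≥3 →
  (λ S → ≤-transᴿ (fromℚ-mono-≤ (Pr≤threshold/n S)) (threshold/n≤ n n≥3)) ,
  (λ D → ≤-transᴿ (Prᴿ≤threshold/n D) (threshold/n≤ n n≥3))
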